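{- Let $p$ be an odd prime and $\alpha$ an indeterminate over $\mathbb F_p$. The coefficients of the polynomial \[ G^{(\alpha)}(X)=-\sum_{k=1}^{p-1}\frac{1}{k}\,\frac{X^{k}}{\prod_{s=1}^{k-1}b_{1,s}(\alpha)}\in\mathbb F_p(\alpha)[X] \] (empty product equal to $1$) belong to the subring $\mathbb F_p[\alpha,(\alpha^{p-1}-1)^{ -1}]$ of $\mathbb F_p(\alpha)$.
   Context: $\mathbb F_p$ is the field of $p$ elements, $\binom{x}{m}=x(x-1)\cdots(x-m+1)/m!$. For integers $0<r,s<p$ (interpreted as elements of $\mathbb F_p$), $b_{r,s}(\alpha)=\sum_{k=0}^{p-1}(-r/s)^k\binom{r\alpha-1}{p-1-k}\binom{s\alpha-1}{k}\in\mathbb F_p[\alpha]$. -}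

module Defs where

open import Algebra.Bundles using (CommutativeRing)
open import Algebra.Bundles.Raw using (RawRing)
import Algebra.Definitions.RawMonoid as RawMonoidDefs
import Algebra.Definitions.RawSemiring as RawSemiringDefs
import Algebra.Properties.Ring as RingProperties
open import Data.Empty using (⊥-elim)
open import Data.Fin.Base using (Fin; toℕ)
open import Data.Fin.Properties using (toℕ<n)
open import Data.Integer.Base as ℤ using (ℤ; +_; 0ℤ; 1ℤ)
open import Data.Integer.Divisibility.Signed as ℤ∣ using (divides; ∣⇒∣ᵤ; ∣ᵤ⇒∣)
import Data.Integer.Properties as ℤₚ
open import Data.Integer.Tactic.RingSolver using (solve-∀)
open import Data.List.Base using (List; []; _∷_; map; replicate; _++_)
open import Data.Nat.Base as ℕ using (ℕ; zero; suc; _∸_; _<_; _!; z≤n; s≤s)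
open import Data.Nat.Coprimality using (Coprime; coprime-Bézout)
open import Data.Nat.Divisibility using (_∣_; _∤_; ∣⇒≤)
open import Data.Nat.GCD using (module Bézout)
open import Data.Nat.Primality
  using (Prime; prime⇒irreducible; prime⇒nonTrivial; euclidsLemma)
import Data.Nat.Properties as ℕₚ
open import Data.Product.Base using (∃; _,_; proj₁)
open import Data.Sum.Base using (_⊎_; inj₁; inj₂; [_,_]′)
open import Level using (Level; _⊔_; 0ℓ)
open import Relation.Binary.PropositionalEquality as ≡ using (_≡_; cong)
import Relation.Binary.Reasoning.Setoid as SetoidReasoning
open import Relation.Nullary.Negation using (¬_)

private
  variable
    c ℓ s : Level

-- Univariate polynomials: coefficient lists, constant term first, compared
-- coefficientwise (so trailing zeros are irrelevant).

module Polynomial (R : RawRing c ℓ) where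
  private module R = RawRing R

  Poly : Set c
  Poly = List R.Carrier

  coeff : Poly → ℕ → R.Carrier
  coeff []      _       = R.0#
  coeff (a ∷ f) zero    = a
  coeff (a ∷ f) (suc n) = coeff f n

  infix  4 _≈_
  infix  8 -_
  infixl 7 _*_
  infixl 6 _+_

  record _≈_ (f g : Poly) : Set ℓ where
    constructor coeffwise
    field coeff-≈ : ∀ n → coeff f n R.≈ coeff g n
  open _≈_ public

  _+_ : Poly → Poly → Poly
  []      + g       = g
  (a ∷ f) + []      = a ∷ f
  (a ∷ f) + (b ∷ g) = (a R.+ b) ∷ (f + g)

  _*_ : Poly → Poly → Poly
  []      * g = []
  (a ∷ f) * g = map (a R.*_) g + (R.0# ∷ f * g)

  -_ : Poly → Poly
  -_ = map (R.-_)

  constant : R.Carrier → Poly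
  constant a = a ∷ []

  monomial : ℕ → R.Carrier → Poly
  monomial n a = replicate n R.0# ++ a ∷ []

  X : Poly
  X = monomial 1 R.1#

  rawRing : RawRing c ℓ
  rawRing = record
    { Carrier = Poly
    ; _≈_     = _≈_
    ; _+_     = _+_
    ; _*_     = _*_
    ; -_      = -_
    ; 0#      = []
    ; 1#      = constant R.1#
    }

module PolynomialProperties (R : CommutativeRing c ℓ) where
  open CommutativeRing R hiding (rawRing)
  private
    module P = Polynomial (CommutativeRing.rawRing R)
    open P using (Poly; coeff)
  open SetoidReasoning setoid
  open RingProperties ring using (-‿involutive; -0#≈0#)

  coeff-+ : ∀ f g n → coeff (f P.+ g) n ≈ coeff f n + coeff g n
  coeff-+ []      g       n       = sym (+-identityˡ _)
  coeff-+ (a ∷ f) []      n       = sym (+-identityʳ _)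
  coeff-+ (a ∷ f) (b ∷ g) zero    = refl
  coeff-+ (a ∷ f) (b ∷ g) (suc n) = coeff-+ f g n

  coeff-map-* : ∀ a g n → coeff (map (a *_) g) n ≈ a * coeff g n
  coeff-map-* a []      n       = sym (zeroʳ a)
  coeff-map-* a (b ∷ g) zero    = refl
  coeff-map-* a (b ∷ g) (suc n) = coeff-map-* a g n

  coeff-*-zero : ∀ f g → coeff (f P.* g) 0 ≈ coeff f 0 * coeff g 0
  coeff-*-zero []      g = sym (zeroˡ _)
  coeff-*-zero (a ∷ f) g = begin
    coeff (map (a *_) g P.+ (0# ∷ f P.* g)) 0  ≈⟨ coeff-+ (map (a *_) g) _ 0 ⟩
    coeff (map (a *_) g) 0 + 0#                ≈⟨ +-identityʳ _ ⟩
    coeff (map (a *_) g) 0                     ≈⟨ coeff-map-* a g 0 ⟩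
    a * coeff g 0                              ∎

  X*f-1≈0⇒1≈0 : ∀ f → P.X P.* f P.+ P.- P.constant 1# P.≈ [] → 1# ≈ 0#
  X*f-1≈0⇒1≈0 f (P.coeffwise eq) = begin
    1#                                       ≈⟨ -‿involutive 1# ⟨
    - (- 1#)                                 ≈⟨ -‿cong (+-identityˡ _) ⟨
    - (0# + - 1#)                            ≈⟨ -‿cong (+-congʳ (zeroˡ (coeff f 0))) ⟨
    - (0# * coeff f 0 + - 1#)                ≈⟨ -‿cong (+-congʳ (coeff-*-zero P.X f)) ⟨
    - (coeff (P.X P.* f) 0 + - 1#)           ≈⟨ -‿cong (coeff-+ (P.X P.* f) _ 0) ⟨
    - coeff (P.X P.* f P.+ P.- P.constant 1#) 0  ≈⟨ -‿cong (eq 0) ⟩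
    - 0#                                     ≈⟨ -0#≈0# ⟩
    0#                                       ∎

  *-zero∷ : ∀ f {b} g → b ≈ 0# → ∀ n →
            coeff (f P.* (b ∷ g)) n ≈ coeff (0# ∷ f P.* g) n
  *-zero∷ []      g b≈0 zero    = refl
  *-zero∷ []      g b≈0 (suc n) = refl
  *-zero∷ (a ∷ f) g b≈0 zero    =
    trans (+-identityʳ _) (trans (*-congˡ b≈0) (zeroʳ a))
  *-zero∷ (a ∷ f) {b} g b≈0 (suc n) = begin
    coeff (map (a *_) g P.+ f P.* (b ∷ g)) n         ≈⟨ coeff-+ (map (a *_) g) _ n ⟩
    coeff (map (a *_) g) n + coeff (f P.* (b ∷ g)) n ≈⟨ +-congˡ (*-zero∷ f g b≈0 n) ⟩
    coeff (map (a *_) g) n + coeff (0# ∷ f P.* g) n  ≈⟨ coeff-+ (map (a *_) g) _ n ⟨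
    coeff (map (a *_) g P.+ (0# ∷ f P.* g)) n        ∎

  module _ (noZeroDivisors : ∀ {x y} → x * y ≈ 0# → x ≈ 0# ⊎ y ≈ 0#) where

    private
      Zero : Poly → Set ℓ
      Zero f = ∀ n → coeff f n ≈ 0#

      zero∷ : ∀ {a f} → a ≈ 0# → Zero f → Zero (a ∷ f)
      zero∷ a≈0 f≈0 zero    = a≈0
      zero∷ a≈0 f≈0 (suc n) = f≈0 n

      zero-* : ∀ f g → Zero (f P.* g) → Zero f ⊎ Zero g
      zero-* []      g       fg≈0 = inj₁ λ _ → refl
      zero-* (a ∷ f) []      fg≈0 = inj₂ λ _ → refl
      zero-* (a ∷ f) (b ∷ g) fg≈0 =
        [ (λ a≈0 → [ (λ f≈0 → inj₁ (zero∷ a≈0 f≈0)) , inj₂ ]′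
                     (zero-* f (b ∷ g) (rest-a a≈0)))
        , (λ b≈0 → [ inj₁ , (λ g≈0 → inj₂ (zero∷ b≈0 g≈0)) ]′
                     (zero-* (a ∷ f) g (rest-b b≈0)))
        ]′ (noZeroDivisors (trans (sym (+-identityʳ (a * b))) (fg≈0 0)))
        where
        rest-a : a ≈ 0# → Zero (f P.* (b ∷ g))
        rest-a a≈0 n = begin
          coeff (f P.* (b ∷ g)) n
            ≈⟨ +-identityˡ _ ⟨
          0# + coeff (f P.* (b ∷ g)) n
            ≈⟨ +-congʳ (trans (*-congʳ a≈0) (zeroˡ _)) ⟨
          a * coeff g n + coeff (f P.* (b ∷ g)) n
            ≈⟨ +-congʳ (coeff-map-* a g n) ⟨
          coeff (map (a *_) g) n + coeff (f P.* (b ∷ g)) n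
            ≈⟨ coeff-+ (map (a *_) g) _ n ⟨
          coeff (map (a *_) g P.+ f P.* (b ∷ g)) n
            ≈⟨ fg≈0 (suc n) ⟩
          0# ∎

        rest-b : b ≈ 0# → Zero ((a ∷ f) P.* g)
        rest-b b≈0 n = trans (sym (*-zero∷ (a ∷ f) g b≈0 (suc n))) (fg≈0 (suc n))

    *-nonzero : ∀ {f g} → ¬ (f P.≈ []) → ¬ (g P.≈ []) → ¬ (f P.* g P.≈ [])
    *-nonzero {f} {g} f≉0 g≉0 (P.coeffwise fg≈0) =
      [ (λ z → f≉0 (P.coeffwise z)) , (λ z → g≉0 (P.coeffwise z)) ]′ (zero-* f g fg≈0)

module Fractions
  (D : RawRing c ℓ)
  (1≉0 : RawRing._≉_ D (RawRing.1# D) (RawRing.0# D))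
  (*-nonzero : ∀ {x y} → RawRing._≉_ D x (RawRing.0# D) →
               RawRing._≉_ D y (RawRing.0# D) →
               RawRing._≉_ D (RawRing._*_ D x y) (RawRing.0# D))
  where
  private module D = RawRing D

  infix 4 _≈_
  infix 8 -_
  infixl 7 _*_
  infixl 6 _+_

  record Frac : Set (c ⊔ ℓ) where
    constructor frac
    field
      num     : D.Carrier
      den     : D.Carrier
      den≉0   : den D.≉ D.0#
  open Frac public

  record _≈_ (x y : Frac) : Set ℓ where
    constructor cross
    field cross-≈ : num x D.* den y D.≈ num y D.* den x
  open _≈_ public

  _+_ : Frac → Frac → Frac
  frac a b b≉0 + frac a′ b′ b′≉0 =
    frac (a D.* b′ D.+ a′ D.* b) (b D.* b′) (*-nonzero b≉0 b′≉0)

  _*_ : Frac → Frac → Frac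
  frac a b b≉0 * frac a′ b′ b′≉0 = frac (a D.* a′) (b D.* b′) (*-nonzero b≉0 b′≉0)

  -_ : Frac → Frac
  - frac a b b≉0 = frac (D.- a) b b≉0

  embed : D.Carrier → Frac
  embed a = frac a D.1# 1≉0

  reciprocal : ∀ a → a D.≉ D.0# → Frac
  reciprocal a a≉0 = frac D.1# a a≉0

  rawRing : RawRing (c ⊔ ℓ) ℓ
  rawRing = record
    { Carrier = Frac
    ; _≈_     = _≈_
    ; _+_     = _+_
    ; _*_     = _*_
    ; -_      = -_
    ; 0#      = embed D.0#
    ; 1#      = embed D.1#
    }

-- The smallest subring containing S (0# is obtained as 1# + - 1#).

module _ (R : RawRing c ℓ) where
  open RawRing R

  data Generated (S : Carrier → Set s) : Carrier → Set (c ⊔ ℓ ⊔ s) where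
    gen  : ∀ {x} → S x → Generated S x
    one  : Generated S 1#
    add  : ∀ {x y} → Generated S x → Generated S y → Generated S (x + y)
    neg  : ∀ {x} → Generated S x → Generated S (- x)
    mul  : ∀ {x y} → Generated S x → Generated S y → Generated S (x * y)
    resp : ∀ {x y} → x ≈ y → Generated S x → Generated S y

-- The integers with equality modulo p.

module PrimeField (p : ℕ) (p-prime : Prime p) where

  infix 4 _≈_

  record _≈_ (x y : ℤ) : Set where
    constructor congruent
    field p∣x-y : + p ℤ∣.∣ x ℤ.- y
  open _≈_ public

  private
    ≡⇒≈ : ∀ {x y} → x ≡ y → x ≈ y
    ≡⇒≈ {x} ≡.refl = congruent (divides 0ℤ (ℤₚ.+-inverseʳ x))

    sym-lemma : ∀ x y → ℤ.- (x ℤ.- y) ≡ y ℤ.- x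
    sym-lemma = solve-∀

    trans-lemma : ∀ x y z → (x ℤ.- y) ℤ.+ (y ℤ.- z) ≡ x ℤ.- z
    trans-lemma = solve-∀

    +-lemma : ∀ x y u v → (x ℤ.- y) ℤ.+ (u ℤ.- v) ≡ (x ℤ.+ u) ℤ.- (y ℤ.+ v)
    +-lemma = solve-∀

    *-lemma : ∀ x y u v →
              (x ℤ.- y) ℤ.* u ℤ.+ y ℤ.* (u ℤ.- v) ≡ x ℤ.* u ℤ.- y ℤ.* v
    *-lemma = solve-∀

    neg-lemma : ∀ x y → ℤ.- (x ℤ.- y) ≡ (ℤ.- x) ℤ.- (ℤ.- y)
    neg-lemma = solve-∀

    via : ∀ {a b} → a ≡ b → + p ℤ∣.∣ a → + p ℤ∣.∣ b
    via = ≡.subst (+ p ℤ∣.∣_)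

  commutativeRing : CommutativeRing 0ℓ 0ℓ
  commutativeRing = record
    { Carrier = ℤ
    ; _≈_     = _≈_
    ; _+_     = ℤ._+_
    ; _*_     = ℤ._*_
    ; -_      = ℤ.-_
    ; 0#      = 0ℤ
    ; 1#      = 1ℤ
    ; isCommutativeRing = record
      { isRing = record
        { +-isAbelianGroup = record
          { isGroup = record
            { isMonoid = record
              { isSemigroup = record
                { isMagma = record
                  { isEquivalence = record
                    { refl  = ≡⇒≈ ≡.refl
                    ; sym   = λ {x} {y} (congruent d) →
                        congruent (via (sym-lemma x y) (ℤ∣.∣m⇒∣-m d))
                    ; trans = λ {x} {y} {z} (congruent d) (congruent e) →
                        congruent (via (trans-lemma x y z) (ℤ∣.∣m∣n⇒∣m+n d e))
                    }
                  ; ∙-cong = λ {x} {y} {u} {v} (congruent d) (congruent e) →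
                      congruent (via (+-lemma x y u v) (ℤ∣.∣m∣n⇒∣m+n d e))
                  }
                ; assoc = λ x y z → ≡⇒≈ (ℤₚ.+-assoc x y z)
                }
              ; identity = (λ x → ≡⇒≈ (ℤₚ.+-identityˡ x))
                         , (λ x → ≡⇒≈ (ℤₚ.+-identityʳ x))
              }
            ; inverse = (λ x → ≡⇒≈ (ℤₚ.+-inverseˡ x))
                      , (λ x → ≡⇒≈ (ℤₚ.+-inverseʳ x))
            ; ⁻¹-cong = λ {x} {y} (congruent d) →
                congruent (via (neg-lemma x y) (ℤ∣.∣m⇒∣-m d))
            }
          ; comm = λ x y → ≡⇒≈ (ℤₚ.+-comm x y)
          }
        ; *-cong = λ {x} {y} {u} {v} (congruent d) (congruent e) →
            congruent (via (*-lemma x y u v)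
              (ℤ∣.∣m∣n⇒∣m+n (ℤ∣.∣m⇒∣m*n u d) (ℤ∣.∣n⇒∣m*n y e)))
        ; *-assoc    = λ x y z → ≡⇒≈ (ℤₚ.*-assoc x y z)
        ; *-identity = (λ x → ≡⇒≈ (ℤₚ.*-identityˡ x))
                     , (λ x → ≡⇒≈ (ℤₚ.*-identityʳ x))
        ; distrib    = (λ x y z → ≡⇒≈ (ℤₚ.*-distribˡ-+ x y z))
                     , (λ x y z → ≡⇒≈ (ℤₚ.*-distribʳ-+ x y z))
        }
      ; *-comm = λ x y → ≡⇒≈ (ℤₚ.*-comm x y)
      }
    }

  ≈0⇒∣ : ∀ {x} → x ≈ 0ℤ → p ∣ ℤ.∣ x ∣
  ≈0⇒∣ {x} (congruent d) = ∣⇒∣ᵤ (via (ℤₚ.+-identityʳ x) d)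

  ∣⇒≈0 : ∀ {x} → p ∣ ℤ.∣ x ∣ → x ≈ 0ℤ
  ∣⇒≈0 {x} d = congruent (via (≡.sym (ℤₚ.+-identityʳ x)) (∣ᵤ⇒∣ d))

  noZeroDivisors : ∀ {x y} → x ℤ.* y ≈ 0ℤ → x ≈ 0ℤ ⊎ y ≈ 0ℤ
  noZeroDivisors {x} {y} xy≈0 =
    [ (λ d → inj₁ (∣⇒≈0 d)) , (λ d → inj₂ (∣⇒≈0 d)) ]′
      (euclidsLemma ℤ.∣ x ∣ ℤ.∣ y ∣ p-prime
        (≡.subst (p ∣_) (ℤₚ.abs-* x y) (≈0⇒∣ xy≈0)))

  1<p : 1 < p
  1<p = ℕ.nonTrivial⇒n>1 p ⦃ prime⇒nonTrivial p-prime ⦄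

  p∤ : ∀ {n} → 0 < n → n < p → p ∤ n
  p∤ 0<n n<p p∣n = ℕₚ.<⇒≱ n<p (∣⇒≤ ⦃ ℕ.>-nonZero 0<n ⦄ p∣n)

  p∤! : ∀ {m} → m < p → p ∤ m !
  p∤! {zero}  _   = p∤ (s≤s z≤n) 1<p
  p∤! {suc m} m<p p∣ =
    [ p∤ (s≤s z≤n) m<p , p∤! (ℕₚ.<-trans (ℕₚ.n<1+n m) m<p) ]′
      (euclidsLemma (suc m) (m !) p-prime p∣)

  1≉0 : ¬ (1ℤ ≈ 0ℤ)
  1≉0 1≈0 = p∤ (s≤s z≤n) 1<p (≈0⇒∣ 1≈0)

  inverse : ∀ n → p ∤ n → ∃ λ x → (+ n) ℤ.* x ≈ 1ℤ
  inverse n p∤n with coprime-Bézout coprime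
    where
    coprime : Coprime p n
    coprime (d∣p , d∣n) =
      [ (λ d≡1 → d≡1)
      , (λ d≡p → ⊥-elim (p∤n (≡.subst (_∣ n) d≡p d∣n))) ]′
        (prime⇒irreducible p-prime d∣p)
  ... | Bézout.+- x y eq = ℤ.- (+ y) , congruent (divides (ℤ.- (+ x)) (begin
      (+ n) ℤ.* (ℤ.- (+ y)) ℤ.- 1ℤ     ≡⟨ lemma (+ n) (+ y) ⟩
      ℤ.- (1ℤ ℤ.+ (+ y) ℤ.* (+ n))     ≡⟨ cong (λ z → ℤ.- (1ℤ ℤ.+ z)) (ℤₚ.pos-* y n) ⟨
      ℤ.- (+ (1 ℕ.+ y ℕ.* n))          ≡⟨ cong (λ z → ℤ.- (+ z)) eq ⟩
      ℤ.- (+ (x ℕ.* p))                ≡⟨ cong ℤ.-_ (ℤₚ.pos-* x p) ⟩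
      ℤ.- ((+ x) ℤ.* (+ p))            ≡⟨ ℤₚ.neg-distribˡ-* (+ x) (+ p) ⟩
      (ℤ.- (+ x)) ℤ.* (+ p)            ∎))
    where
    open ≡.≡-Reasoning
    lemma : ∀ a b → a ℤ.* (ℤ.- b) ℤ.- 1ℤ ≡ ℤ.- (1ℤ ℤ.+ b ℤ.* a)
    lemma = solve-∀
  ... | Bézout.-+ x y eq = + y , congruent (divides (+ x) (begin
      (+ n) ℤ.* (+ y) ℤ.- 1ℤ           ≡⟨ cong (ℤ._- 1ℤ) (ℤₚ.*-comm (+ n) (+ y)) ⟩
      (+ y) ℤ.* (+ n) ℤ.- 1ℤ           ≡⟨ cong (ℤ._- 1ℤ) (ℤₚ.pos-* y n) ⟨
      (+ (y ℕ.* n)) ℤ.- 1ℤ             ≡⟨ cong (λ z → (+ z) ℤ.- 1ℤ) eq ⟨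
      (1ℤ ℤ.+ (+ (x ℕ.* p))) ℤ.- 1ℤ    ≡⟨ lemma (+ (x ℕ.* p)) ⟩
      + (x ℕ.* p)                      ≡⟨ ℤₚ.pos-* x p ⟩
      (+ x) ℤ.* (+ p)                  ∎))
    where
    open ≡.≡-Reasoning
    lemma : ∀ a → (1ℤ ℤ.+ a) ℤ.- 1ℤ ≡ a
    lemma = solve-∀

  1/ : ∀ n → p ∤ n → ℤ
  1/ n p∤n = proj₁ (inverse n p∤n)

module TruncatedLogarithm (p : ℕ) (p-prime : Prime p) where

  open PrimeField p p-prime public
    using (1<p; p∤; p∤!; 1/)
    renaming (commutativeRing to 𝔽ₚ)
  private
    module F   = PrimeField p p-prime
    module 𝔽   = CommutativeRing 𝔽ₚ

  module 𝔽ₚ[α] where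
    open Polynomial 𝔽.rawRing public
    open RawRing rawRing public using (_≉_; 0#; 1#)
    open RawSemiringDefs (RawRing.rawSemiring rawRing) public using (_^_)
    open RawMonoidDefs (RawRing.+-rawMonoid rawRing) public using () renaming (sum to ∑)
    open RawMonoidDefs (RawRing.*-rawMonoid rawRing) public using () renaming (sum to ∏)

    infixl 6 _-_
    _-_ : Poly → Poly → Poly
    f - g = f + (- g)

    α : Poly
    α = X

    1≉0 : 1# ≉ 0#
    1≉0 1≈0 = F.1≉0 (coeff-≈ 1≈0 0)

    *-nonzero : ∀ {f g} → f ≉ 0# → g ≉ 0# → f * g ≉ 0#
    *-nonzero = PolynomialProperties.*-nonzero 𝔽ₚ F.noZeroDivisors

  module 𝔽ₚ⟨α⟩ where
    open Fractions 𝔽ₚ[α].rawRing 𝔽ₚ[α].1≉0 𝔽ₚ[α].*-nonzero public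

  module 𝔽ₚ⟨α⟩[X] where
    open Polynomial 𝔽ₚ⟨α⟩.rawRing public
    open RawMonoidDefs (RawRing.+-rawMonoid rawRing) public using () renaming (sum to ∑)

  open 𝔽ₚ[α]
  open RawSemiringDefs (RawRing.rawSemiring 𝔽.rawRing)
    using () renaming (_^_ to _^ₚ_)

  p∸1<p : p ∸ 1 < p
  p∸1<p = ℕₚ.∸-monoʳ-< (s≤s z≤n) (ℕₚ.<⇒≤ 1<p)

  1+toℕ<p : (j : Fin (p ∸ 1)) → suc (toℕ j) < p
  1+toℕ<p j = ℕₚ.≤-<-trans (toℕ<n j) p∸1<p

  binomial : Poly → (m : ℕ) → m < p → Poly
  binomial x m m<p =
    constant (1/ (m !) (p∤! m<p)) * ∏ {m} λ i → x - constant (+ toℕ i)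

  b : (r s : ℕ) → 0 < s → s < p → Poly
  b r s 0<s s<p = ∑ {p} λ k →
    constant ((𝔽.- (+ r) 𝔽.* 1/ s (p∤ 0<s s<p)) ^ₚ toℕ k)
    * binomial (constant (+ r) * α - 1#) (p ∸ 1 ∸ toℕ k)
        (ℕₚ.≤-<-trans (ℕₚ.m∸n≤m (p ∸ 1) (toℕ k)) p∸1<p)
    * binomial (constant (+ s) * α - 1#) (toℕ k) (toℕ<n k)

  -- ∏b j is the product of b 1 s over 1 ≤ s ≤ j.

  ∏b : (j : ℕ) → j < p → Poly
  ∏b j j<p = ∏ {j} λ i → b 1 (suc (toℕ i)) (s≤s z≤n) (ℕₚ.≤-<-trans (toℕ<n i) j<p)

  -- The exponent k = 1, …, p - 1 is suc (toℕ j), so that denominator j is the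
  -- product over 1 ≤ s ≤ k - 1.

  denominator : Fin (p ∸ 1) → Poly
  denominator j = ∏b (toℕ j) (ℕₚ.<-trans (ℕₚ.n<1+n (toℕ j)) (1+toℕ<p j))

  G : (∀ j → denominator j ≉ 0#) → 𝔽ₚ⟨α⟩[X].Poly
  G denominator≉0 = 𝔽ₚ⟨α⟩[X].- 𝔽ₚ⟨α⟩[X].∑ {p ∸ 1} λ j →
    𝔽ₚ⟨α⟩[X].monomial (suc (toℕ j))
      (𝔽ₚ⟨α⟩.embed (constant (1/ (suc (toℕ j)) (p∤ (s≤s z≤n) (1+toℕ<p j))))
       𝔽ₚ⟨α⟩.* 𝔽ₚ⟨α⟩.reciprocal (denominator j) (denominator≉0 j))

  αᵖ⁻¹-1≉0 : α ^ (p ∸ 1) - 1# ≉ 0#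
  αᵖ⁻¹-1≉0 eq with p ∸ 1 | ℕₚ.∸-monoˡ-≤ 1 1<p
  ... | suc m | _ = F.1≉0 (PolynomialProperties.X*f-1≈0⇒1≈0 𝔽ₚ (α ^ m) eq)

  data Generator : 𝔽ₚ⟨α⟩.Frac → Set where
    scalar        : ∀ a → Generator (𝔽ₚ⟨α⟩.embed (constant a))
    indeterminate : Generator (𝔽ₚ⟨α⟩.embed α)
    [αᵖ⁻¹-1]⁻¹    : Generator (𝔽ₚ⟨α⟩.reciprocal (α ^ (p ∸ 1) - 1#) αᵖ⁻¹-1≉0)

  𝔽ₚ[α,1/αᵖ⁻¹-1] : 𝔽ₚ⟨α⟩.Frac → Set
  𝔽ₚ[α,1/αᵖ⁻¹-1] = Generated 𝔽ₚ⟨α⟩.rawRing Generator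

{-# OPTIONS --safe #-}
module Submission where

-- For t = 1/s the polynomial b = b₁ₛ(α) is the coefficient of X^(p-1) in
-- (1 + X)^(α-1) (1 - tX)^(sα-1). The differential equation of this series gives recurrences for its
-- coefficients in which the terms linear in α cancel, so that b has degree exactly (p-1)/2. On the
-- other hand b vanishes at a when the residues of a and s a in {1, …, p-1} have sum at most p, because
-- then every summand has a vanishing factor; one of ±a always qualifies. Hence b is a constant times
-- a product of linear factors α - a with a ≠ 0, and each of these divides α^(p-1) - 1 by Fermat.

open import Defs
open import Algebra.Bundles using (CommutativeRing)
import Algebra.Definitions.RawMonoid as RawMonoidDefs
import Algebra.Properties.CommutativeMonoid.Mult as CommutativeMonoidMult
import Algebra.Properties.CommutativeSemigroup as CommutativeSemigroupProperties
import Algebra.Properties.CommutativeSemiring.Binomial as Binomial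
import Algebra.Properties.Monoid.Mult as MonoidMult
import Algebra.Properties.Monoid.Sum as MonoidSum
import Algebra.Properties.Ring as RingProperties
import Algebra.Properties.Semiring.Exp as SemiringExp
import Algebra.Properties.Semiring.Mult as SemiringMult
import Algebra.Solver.Ring.NaturalCoefficients.Default as NaturalCoefficients
open import Data.Empty using (⊥-elim)
open import Data.Fin.Base using (Fin; zero; suc; toℕ; fromℕ; fromℕ<; inject₁)
open import Data.Fin.Properties using (toℕ<n; toℕ-inject₁; toℕ-fromℕ; toℕ-fromℕ<)
open import Data.Integer.Base as ℤ using (ℤ; +_; -[1+_]; -1ℤ; 0ℤ; 1ℤ)
import Data.Integer.Divisibility.Signed as ℤ∣
import Data.Integer.Properties as ℤₚ
open import Data.Integer.Tactic.RingSolver using (solve-∀)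
open import Data.List.Base using ([]; _∷_; map)
open import Data.Nat.Base as ℕ using (ℕ; zero; suc; _≤_; _<_; _∸_; _!; z≤n; s≤s)
open import Data.Nat.Combinatorics using (_C_; nCn≡1; nCk≡n!/k![n-k]!; k![n∸k]!∣n!)
open import Data.Nat.DivMod using (_%_; _/_; m≡m%n+[m/n]*n; m%n<n; m/n*n≡m)
open import Data.Nat.Divisibility using (_∣_; _∤_; ∣-refl; m∣m*n; n∣m*n; m%n≡0⇒n∣m)
open import Data.Nat.Primality using (Prime; ¬prime[0]; euclidsLemma)
import Data.Nat.Properties as ℕₚ
open import Data.Product.Base using (Σ; ∃; _×_; _,_; proj₁; proj₂)
open import Data.Sum.Base using (_⊎_; inj₁; inj₂; [_,_]′)
open import Function.Base using (_∘_)
open import Level using (Level)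
open import Relation.Binary.Bundles using (Setoid)
open import Relation.Binary.PropositionalEquality as ≡ using (_≡_)
import Relation.Binary.Reasoning.Setoid as SetoidReasoning
open import Relation.Binary.Structures using (IsEquivalence)
open import Relation.Nullary.Decidable.Core using (yes; no)
open import Relation.Nullary.Negation using (¬_)

-- The halving of the degree is visible in the logarithm: log (1 + X) + s log (1 - tX) has no linear
-- term when st = 1 and starts with -(1 + t)/2 X². Formally the series is thus exp (α O(X²)) times a
-- series without α, so each α costs X², and α^m enters at X^(2m) with coefficient (-(1 + t)/2)^m /
-- m!. Below X^p the recurrences turn this into an argument without exp or log. The coefficient is
-- nonzero unless t = -1, that is s = p - 1; in that case the series is (1 + X)^(-2) and b is 0, but
-- this s does not occur in the denominators. Exactness of the degree matters twice. The p - 1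
-- nonzero classes form (p - 1)/2 pairs ±a and each pair yields a root, so the roots found exhaust
-- the degree and leave only a constant cofactor; and the leading coefficient shows that b, hence
-- this constant, is nonzero. Nonvanishing of the denominators is itself part of the claim, since
-- without it G is not defined.

private
  variable
    c ℓ : Level

-- Polynomials over a commutative ring form a commutative ring.

module PolynomialRing (R : CommutativeRing c ℓ) where
  private module R = CommutativeRing R
  open RingProperties R.ring using (-0#≈0#)
  open Polynomial R.rawRing
  open PolynomialProperties R

  private
    _⊕_ = R._+_
    _⊛_ = R._*_

    medial : ∀ w x y z → (w ⊕ x) ⊕ (y ⊕ z) R.≈ (w ⊕ y) ⊕ (x ⊕ z)
    medial w x y z = begin
      (w ⊕ x) ⊕ (y ⊕ z)  ≈⟨ R.+-assoc w x _ ⟩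
      w ⊕ (x ⊕ (y ⊕ z))  ≈⟨ R.+-congˡ (R.+-assoc x y z) ⟨
      w ⊕ ((x ⊕ y) ⊕ z)  ≈⟨ R.+-congˡ (R.+-congʳ (R.+-comm x y)) ⟩
      w ⊕ ((y ⊕ x) ⊕ z)  ≈⟨ R.+-congˡ (R.+-assoc y x z) ⟩
      w ⊕ (y ⊕ (x ⊕ z))  ≈⟨ R.+-assoc w y _ ⟨
      (w ⊕ y) ⊕ (x ⊕ z)  ∎
      where open SetoidReasoning R.setoid

  ≈-refl : ∀ {f} → f ≈ f
  ≈-refl = coeffwise λ _ → R.refl

  ≈-sym : ∀ {f g} → f ≈ g → g ≈ f
  ≈-sym (coeffwise eq) = coeffwise λ n → R.sym (eq n)

  ≈-trans : ∀ {f g h} → f ≈ g → g ≈ h → f ≈ h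
  ≈-trans (coeffwise eq₁) (coeffwise eq₂) = coeffwise λ n → R.trans (eq₁ n) (eq₂ n)

  isEquivalence : IsEquivalence _≈_
  isEquivalence = record { refl = ≈-refl ; sym = ≈-sym ; trans = ≈-trans }

  private
    setoid : Setoid c ℓ
    setoid = record { isEquivalence = isEquivalence }

  coeff-neg : ∀ f n → coeff (- f) n R.≈ R.- coeff f n
  coeff-neg []      n       = R.sym -0#≈0#
  coeff-neg (a ∷ f) zero    = R.refl
  coeff-neg (a ∷ f) (suc n) = coeff-neg f n

  ∷-cong : ∀ {a b f g} → a R.≈ b → f ≈ g → (a ∷ f) ≈ (b ∷ g)
  ∷-cong a≈b f≈g = coeffwise λ { zero → a≈b ; (suc n) → coeff-≈ f≈g n }

  map-*-cong : ∀ {a b f g} → a R.≈ b → f ≈ g → map (a ⊛_) f ≈ map (b ⊛_) g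
  map-*-cong {a} {b} {f} {g} a≈b f≈g = coeffwise λ n →
    R.trans (coeff-map-* a f n)
      (R.trans (R.*-cong a≈b (coeff-≈ f≈g n)) (R.sym (coeff-map-* b g n)))

  +-cong : ∀ {f f′ g g′} → f ≈ f′ → g ≈ g′ → f + g ≈ f′ + g′
  +-cong {f} {f′} {g} {g′} f≈f′ g≈g′ = coeffwise λ n →
    R.trans (coeff-+ f g n)
      (R.trans (R.+-cong (coeff-≈ f≈f′ n) (coeff-≈ g≈g′ n)) (R.sym (coeff-+ f′ g′ n)))

  neg-cong : ∀ {f g} → f ≈ g → - f ≈ - g
  neg-cong {f} {g} f≈g = coeffwise λ n →
    R.trans (coeff-neg f n) (R.trans (R.-‿cong (coeff-≈ f≈g n)) (R.sym (coeff-neg g n)))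

  +-assoc : ∀ f g h → (f + g) + h ≈ f + (g + h)
  +-assoc f g h = coeffwise λ n → begin
    coeff ((f + g) + h) n                 ≈⟨ coeff-+ (f + g) h n ⟩
    coeff (f + g) n ⊕ coeff h n           ≈⟨ R.+-congʳ (coeff-+ f g n) ⟩
    (coeff f n ⊕ coeff g n) ⊕ coeff h n   ≈⟨ R.+-assoc _ _ _ ⟩
    coeff f n ⊕ (coeff g n ⊕ coeff h n)   ≈⟨ R.+-congˡ (coeff-+ g h n) ⟨
    coeff f n ⊕ coeff (g + h) n           ≈⟨ coeff-+ f (g + h) n ⟨
    coeff (f + (g + h)) n                 ∎
    where open SetoidReasoning R.setoid

  +-comm : ∀ f g → f + g ≈ g + f
  +-comm f g = coeffwise λ n →
    R.trans (coeff-+ f g n) (R.trans (R.+-comm _ _) (R.sym (coeff-+ g f n)))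

  +-identityʳ : ∀ f → f + [] ≈ f
  +-identityʳ []      = ≈-refl
  +-identityʳ (a ∷ f) = ≈-refl

  +-inverseʳ : ∀ f → f + - f ≈ []
  +-inverseʳ f = coeffwise λ n →
    R.trans (coeff-+ f (- f) n) (R.trans (R.+-congˡ (coeff-neg f n)) (R.-‿inverseʳ _))

  +-medial : ∀ f g h k → (f + g) + (h + k) ≈ (f + h) + (g + k)
  +-medial f g h k = coeffwise λ n → begin
    coeff ((f + g) + (h + k)) n                             ≈⟨ coeff-+ (f + g) _ n ⟩
    coeff (f + g) n ⊕ coeff (h + k) n                       ≈⟨ R.+-cong (coeff-+ f g n) (coeff-+ h k n) ⟩
    (coeff f n ⊕ coeff g n) ⊕ (coeff h n ⊕ coeff k n)       ≈⟨ medial _ _ _ _ ⟩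
    (coeff f n ⊕ coeff h n) ⊕ (coeff g n ⊕ coeff k n)       ≈⟨ R.+-cong (coeff-+ f h n) (coeff-+ g k n) ⟨
    coeff (f + h) n ⊕ coeff (g + k) n                       ≈⟨ coeff-+ (f + h) _ n ⟨
    coeff ((f + h) + (g + k)) n                             ∎
    where open SetoidReasoning R.setoid

  0∷-+ : ∀ f g → (R.0# ∷ f + g) ≈ (R.0# ∷ f) + (R.0# ∷ g)
  0∷-+ f g = ∷-cong (R.sym (R.+-identityˡ R.0#)) ≈-refl

  map-*-+ : ∀ a f g → map (a ⊛_) (f + g) ≈ map (a ⊛_) f + map (a ⊛_) g
  map-*-+ a f g = coeffwise λ n → begin
    coeff (map (a ⊛_) (f + g)) n                        ≈⟨ coeff-map-* a (f + g) n ⟩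
    a ⊛ coeff (f + g) n                                 ≈⟨ R.*-congˡ (coeff-+ f g n) ⟩
    a ⊛ (coeff f n ⊕ coeff g n)                         ≈⟨ R.distribˡ a _ _ ⟩
    (a ⊛ coeff f n) ⊕ (a ⊛ coeff g n)                   ≈⟨ R.+-cong (coeff-map-* a f n) (coeff-map-* a g n) ⟨
    coeff (map (a ⊛_) f) n ⊕ coeff (map (a ⊛_) g) n     ≈⟨ coeff-+ (map (a ⊛_) f) _ n ⟨
    coeff (map (a ⊛_) f + map (a ⊛_) g) n               ∎
    where open SetoidReasoning R.setoid

  map-*-map-* : ∀ a b f → map (a ⊛_) (map (b ⊛_) f) ≈ map ((a ⊛ b) ⊛_) f
  map-*-map-* a b []      = ≈-refl
  map-*-map-* a b (d ∷ f) = ∷-cong (R.sym (R.*-assoc a b d)) (map-*-map-* a b f)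

  map-1* : ∀ f → map (R.1# ⊛_) f ≈ f
  map-1* f = coeffwise λ n → R.trans (coeff-map-* R.1# f n) (R.*-identityˡ _)

  map-0* : ∀ f → map (R.0# ⊛_) f ≈ []
  map-0* f = coeffwise λ n → R.trans (coeff-map-* R.0# f n) (R.zeroˡ _)

  *-congˡ : ∀ f {g h} → g ≈ h → f * g ≈ f * h
  *-congˡ []      g≈h = ≈-refl
  *-congˡ (a ∷ f) g≈h = +-cong (map-*-cong R.refl g≈h) (∷-cong R.refl (*-congˡ f g≈h))

  0∷[]≈[] : (R.0# ∷ []) ≈ []
  0∷[]≈[] = coeffwise λ { zero → R.refl ; (suc n) → R.refl }

  *-zeroʳ : ∀ f → f * [] ≈ []
  *-zeroʳ []      = ≈-refl
  *-zeroʳ (a ∷ f) = ≈-trans (∷-cong R.refl (*-zeroʳ f)) 0∷[]≈[]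

  -- Multiplication recurses on its first argument; this is the same recursion in the second, which
  -- the induction for `*-comm` needs.
  *-∷ : ∀ f b g → f * (b ∷ g) ≈ map (b ⊛_) f + (R.0# ∷ f * g)
  *-∷ []      b g = ≈-sym 0∷[]≈[]
  *-∷ (a ∷ f) b g = ∷-cong {f = map (a ⊛_) g + f * (b ∷ g)} (R.+-congʳ (R.*-comm a b)) (begin
    map (a ⊛_) g + f * (b ∷ g)                       ≈⟨ +-cong {map (a ⊛_) g} ≈-refl (*-∷ f b g) ⟩
    map (a ⊛_) g + (map (b ⊛_) f + (R.0# ∷ f * g))   ≈⟨ +-assoc (map (a ⊛_) g) (map (b ⊛_) f) _ ⟨
    (map (a ⊛_) g + map (b ⊛_) f) + (R.0# ∷ f * g)   ≈⟨ +-cong (+-comm (map (a ⊛_) g) (map (b ⊛_) f)) ≈-refl ⟩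
    (map (b ⊛_) f + map (a ⊛_) g) + (R.0# ∷ f * g)   ≈⟨ +-assoc (map (b ⊛_) f) (map (a ⊛_) g) _ ⟩
    map (b ⊛_) f + (map (a ⊛_) g + (R.0# ∷ f * g))   ∎)
    where
    open SetoidReasoning setoid

  *-comm : ∀ f g → f * g ≈ g * f
  *-comm []      g = ≈-sym (*-zeroʳ g)
  *-comm (a ∷ f) g =
    ≈-trans (+-cong {map (a ⊛_) g} ≈-refl (∷-cong R.refl (*-comm f g))) (≈-sym (*-∷ g a f))

  *-congʳ : ∀ f {g h} → g ≈ h → g * f ≈ h * f
  *-congʳ f {g} {h} g≈h =
    ≈-trans (*-comm g f) (≈-trans (*-congˡ f g≈h) (*-comm f h))

  *-distribˡ-+ : ∀ f g h → f * (g + h) ≈ f * g + f * h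
  *-distribˡ-+ []      g h = ≈-refl
  *-distribˡ-+ (a ∷ f) g h = ≈-trans
    (+-cong (map-*-+ a g h)
      (≈-trans (∷-cong R.refl (*-distribˡ-+ f g h)) (0∷-+ (f * g) (f * h))))
    (+-medial (map (a ⊛_) g) (map (a ⊛_) h) _ _)

  *-distribʳ-+ : ∀ f g h → (g + h) * f ≈ g * f + h * f
  *-distribʳ-+ f g h = ≈-trans (*-comm (g + h) f)
    (≈-trans (*-distribˡ-+ f g h) (+-cong (*-comm f g) (*-comm f h)))

  map-*-* : ∀ a f g → map (a ⊛_) f * g ≈ map (a ⊛_) (f * g)
  map-*-* a []      g = ≈-refl
  map-*-* a (b ∷ f) g = ≈-trans
    (+-cong (≈-sym (map-*-map-* a b g)) (∷-cong (R.sym (R.zeroʳ a)) (map-*-* a f g)))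
    (≈-sym (map-*-+ a (map (b ⊛_) g) (R.0# ∷ f * g)))

  0∷-* : ∀ f g → (R.0# ∷ f) * g ≈ (R.0# ∷ f * g)
  0∷-* f g = +-cong (map-0* g) ≈-refl

  *-assoc : ∀ f g h → (f * g) * h ≈ f * (g * h)
  *-assoc []      g h = ≈-refl
  *-assoc (a ∷ f) g h = ≈-trans (*-distribʳ-+ h (map (a ⊛_) g) (R.0# ∷ f * g))
    (+-cong (map-*-* a g h)
      (≈-trans (0∷-* (f * g) h) (∷-cong R.refl (*-assoc f g h))))

  *-identityˡ : ∀ f → constant R.1# * f ≈ f
  *-identityˡ f = ≈-trans (+-cong (map-1* f) 0∷[]≈[]) (+-identityʳ f)

  commutativeRing : CommutativeRing c ℓ
  commutativeRing = record
    { Carrier = Poly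
    ; _≈_     = _≈_
    ; _+_     = _+_
    ; _*_     = _*_
    ; -_      = -_
    ; 0#      = []
    ; 1#      = constant R.1#
    ; isCommutativeRing = record
      { isRing = record
        { +-isAbelianGroup = record
          { isGroup = record
            { isMonoid = record
              { isSemigroup = record
                { isMagma = record
                  { isEquivalence = isEquivalence
                  ; ∙-cong = +-cong
                  }
                ; assoc = +-assoc
                }
              ; identity = (λ _ → ≈-refl) , +-identityʳ
              }
            ; inverse = (λ f → ≈-trans (+-comm (- f) f) (+-inverseʳ f)) , +-inverseʳ
            ; ⁻¹-cong = neg-cong
            }
          ; comm = +-comm
          }
        ; *-cong = λ {f} {f′} {g} {g′} f≈f′ g≈g′ →
            ≈-trans (*-congʳ g f≈f′) (*-congˡ f′ g≈g′)
        ; *-assoc    = *-assoc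
        ; *-identity = *-identityˡ
                     , λ f → ≈-trans (*-comm f _) (*-identityˡ f)
        ; distrib    = *-distribˡ-+ , *-distribʳ-+
        }
      ; *-comm = *-comm
      }
    }

-- Evaluation and division by linear factors.

module Evaluation (R : CommutativeRing c ℓ) where
  open CommutativeRing R hiding (zero)
  open RingProperties ring using (-0#≈0#; -‿+-comm; -‿distribʳ-*)
  open PolynomialProperties R
  open SetoidReasoning setoid
  private
    module P = Polynomial (CommutativeRing.rawRing R)
    open P using (Poly; coeff)
  open NaturalCoefficients commutativeSemiring using (solve; con; _:+_; _:*_; _:=_)

  eval : Carrier → Poly → Carrier
  eval x []      = 0#
  eval x (a ∷ f) = a + x * eval x f

  eval-≈0 : ∀ x f → (∀ n → coeff f n ≈ 0#) → eval x f ≈ 0#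
  eval-≈0 x []      f≈0 = refl
  eval-≈0 x (a ∷ f) f≈0 = begin
    a + x * eval x f  ≈⟨ +-cong (f≈0 0) (*-congˡ (eval-≈0 x f (f≈0 ∘ suc))) ⟩
    0# + x * 0#       ≈⟨ +-identityˡ _ ⟩
    x * 0#            ≈⟨ zeroʳ x ⟩
    0#                ∎

  eval-cong : ∀ x f g → f P.≈ g → eval x f ≈ eval x g
  eval-cong x []      g       (P.coeffwise eq) = sym (eval-≈0 x g λ n → sym (eq n))
  eval-cong x (a ∷ f) []      (P.coeffwise eq) = eval-≈0 x (a ∷ f) eq
  eval-cong x (a ∷ f) (b ∷ g) (P.coeffwise eq) =
    +-cong (eq 0) (*-congˡ (eval-cong x f g (P.coeffwise (eq ∘ suc))))

  eval-+ : ∀ x f g → eval x (f P.+ g) ≈ eval x f + eval x g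
  eval-+ x []      g       = sym (+-identityˡ _)
  eval-+ x (a ∷ f) []      = sym (+-identityʳ _)
  eval-+ x (a ∷ f) (b ∷ g) = trans (+-congˡ (*-congˡ (eval-+ x f g))) (lemma a b x _ _)
    where
    lemma : ∀ a b x y z → a + b + x * (y + z) ≈ a + x * y + (b + x * z)
    lemma = solve 5 (λ a b x y z → a :+ b :+ x :* (y :+ z) := a :+ x :* y :+ (b :+ x :* z)) refl

  eval-neg : ∀ x f → eval x (P.- f) ≈ - eval x f
  eval-neg x []      = sym -0#≈0#
  eval-neg x (a ∷ f) = begin
    - a + x * eval x (P.- f)  ≈⟨ +-congˡ (*-congˡ (eval-neg x f)) ⟩
    - a + x * - eval x f      ≈⟨ +-congˡ (-‿distribʳ-* x _) ⟨
    - a + - (x * eval x f)    ≈⟨ -‿+-comm a _ ⟩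
    - (a + x * eval x f)      ∎

  eval-map-* : ∀ x a f → eval x (map (a *_) f) ≈ a * eval x f
  eval-map-* x a []      = sym (zeroʳ a)
  eval-map-* x a (b ∷ f) = trans (+-congˡ (*-congˡ (eval-map-* x a f))) (lemma a b x _)
    where
    lemma : ∀ a b x y → a * b + x * (a * y) ≈ a * (b + x * y)
    lemma = solve 4 (λ a b x y → a :* b :+ x :* (a :* y) := a :* (b :+ x :* y)) refl

  eval-* : ∀ x f g → eval x (f P.* g) ≈ eval x f * eval x g
  eval-* x []      g = sym (zeroˡ _)
  eval-* x (a ∷ f) g = begin
    eval x (map (a *_) g P.+ (0# ∷ f P.* g))
      ≈⟨ eval-+ x (map (a *_) g) _ ⟩
    eval x (map (a *_) g) + (0# + x * eval x (f P.* g))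
      ≈⟨ +-cong (eval-map-* x a g) (trans (+-identityˡ _) (*-congˡ (eval-* x f g))) ⟩
    a * eval x g + x * (eval x f * eval x g)
      ≈⟨ lemma a x _ _ ⟩
    (a + x * eval x f) * eval x g ∎
    where
    lemma : ∀ a x y z → a * z + x * (y * z) ≈ (a + x * y) * z
    lemma = solve 4 (λ a x y z → a :* z :+ x :* (y :* z) := (a :+ x :* y) :* z) refl

  eval-constant : ∀ x a → eval x (P.constant a) ≈ a
  eval-constant x a = trans (+-congˡ (zeroʳ x)) (+-identityʳ a)

  eval-X : ∀ x → eval x P.X ≈ x
  eval-X x = lemma x
    where
    lemma : ∀ x → 0# + x * (1# + x * 0#) ≈ x
    lemma = solve 1 (λ x → con 0 :+ x :* (con 1 :+ x :* con 0) := x) refl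

  coeff-linear-* : ∀ a b f n →
    coeff ((a ∷ b ∷ []) P.* f) (suc n) ≈ a * coeff f (suc n) + b * coeff f n
  coeff-linear-* a b f n = begin
    coeff (map (a *_) f P.+ (0# ∷ (map (b *_) f P.+ (0# ∷ [])))) (suc n)
      ≈⟨ coeff-+ (map (a *_) f) _ (suc n) ⟩
    coeff (map (a *_) f) (suc n) + coeff (map (b *_) f P.+ (0# ∷ [])) n
      ≈⟨ +-cong (coeff-map-* a f (suc n)) (coeff-+ (map (b *_) f) _ n) ⟩
    a * coeff f (suc n) + (coeff (map (b *_) f) n + coeff (0# ∷ []) n)
      ≈⟨ +-congˡ (+-cong (coeff-map-* b f n) (0∷[] n)) ⟩
    a * coeff f (suc n) + (b * coeff f n + 0#)
      ≈⟨ +-congˡ (+-identityʳ _) ⟩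
    a * coeff f (suc n) + b * coeff f n ∎
    where
    0∷[] : ∀ n → coeff (0# ∷ []) n ≈ 0#
    0∷[] zero    = refl
    0∷[] (suc n) = refl

  -- Horner's scheme: the quotient of f by X - x; the remainder is eval x f.

  quotient : Carrier → Poly → Poly
  quotient x []      = []
  quotient x (a ∷ f) = eval x f ∷ quotient x f

  private
    coeff-zero : ∀ x f → eval x f + - x * coeff (quotient x f) 0 ≈ coeff f 0
    coeff-zero x []      = trans (+-identityˡ _) (zeroʳ _)
    coeff-zero x (a ∷ f) = begin
      a + x * eval x f + - x * eval x f    ≈⟨ +-assoc _ _ _ ⟩
      a + (x * eval x f + - x * eval x f)  ≈⟨ +-congˡ (distribʳ _ x (- x)) ⟨
      a + (x + - x) * eval x f             ≈⟨ +-congˡ (*-congʳ (-‿inverseʳ x)) ⟩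
      a + 0# * eval x f                    ≈⟨ +-congˡ (zeroˡ _) ⟩
      a + 0#                               ≈⟨ +-identityʳ a ⟩
      a                                    ∎

    coeff-suc : ∀ x f n →
      coeff (quotient x f) n + - x * coeff (quotient x f) (suc n) ≈ coeff f (suc n)
    coeff-suc x []      n       = trans (+-identityˡ _) (zeroʳ _)
    coeff-suc x (a ∷ f) zero    = coeff-zero x f
    coeff-suc x (a ∷ f) (suc n) = coeff-suc x f n

  quotient-root : ∀ x f → eval x f ≈ 0# → f P.≈ (P.X P.+ P.- P.constant x) P.* quotient x f
  quotient-root x f f[x]≈0 = P.coeffwise λ { zero → sym (at-zero) ; (suc n) → sym (at-suc n) }
    where
    q : Poly
    q = quotient x f

    at-zero : coeff ((P.X P.+ P.- P.constant x) P.* q) 0 ≈ coeff f 0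
    at-zero = begin
      coeff ((P.X P.+ P.- P.constant x) P.* q) 0  ≈⟨ coeff-*-zero (P.X P.+ P.- P.constant x) q ⟩
      (0# + - x) * coeff q 0                      ≈⟨ *-congʳ (+-identityˡ _) ⟩
      - x * coeff q 0                             ≈⟨ +-identityˡ _ ⟨
      0# + - x * coeff q 0                        ≈⟨ +-congʳ f[x]≈0 ⟨
      eval x f + - x * coeff q 0                  ≈⟨ coeff-zero x f ⟩
      coeff f 0                                   ∎

    at-suc : ∀ n → coeff ((P.X P.+ P.- P.constant x) P.* q) (suc n) ≈ coeff f (suc n)
    at-suc n = begin
      coeff ((P.X P.+ P.- P.constant x) P.* q) (suc n)  ≈⟨ coeff-linear-* _ _ q n ⟩
      (0# + - x) * coeff q (suc n) + 1# * coeff q n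
        ≈⟨ +-cong (*-congʳ (+-identityˡ _)) (*-identityˡ _) ⟩
      - x * coeff q (suc n) + coeff q n                 ≈⟨ +-comm _ _ ⟩
      coeff q n + - x * coeff q (suc n)                 ≈⟨ coeff-suc x f n ⟩
      coeff f (suc n)                                   ∎

  -- Coefficient n of `quotient x f` is the value at x of f with its first n + 1 coefficients
  -- dropped, so it depends only on the coefficients of f above n.
  quotient-degree : ∀ x f d → (∀ n → suc d < n → coeff f n ≈ 0#) →
                    ∀ n → d < n → coeff (quotient x f) n ≈ 0#
  quotient-degree x []      d deg n       d<n = refl
  quotient-degree x (a ∷ f) zero    deg (suc n) d<n =
    quotient-≈0 x f n (λ m n<m → deg (suc m) (s≤s (ℕₚ.≤-trans (s≤s z≤n) n<m)))
    where
    quotient-≈0 : ∀ x f n → (∀ m → n < m → coeff f m ≈ 0#) → coeff (quotient x f) n ≈ 0#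
    quotient-≈0 x []      n       f≈0 = refl
    quotient-≈0 x (a ∷ f) zero    f≈0 = eval-≈0 x f λ m → f≈0 (suc m) (s≤s z≤n)
    quotient-≈0 x (a ∷ f) (suc n) f≈0 = quotient-≈0 x f n λ m n<m → f≈0 (suc m) (s≤s n<m)
  quotient-degree x (a ∷ f) (suc d) deg (suc n) (s≤s d<n) =
    quotient-degree x f d (λ m d<m → deg (suc m) (s≤s d<m)) n d<n

-- Power series as sequences: Cauchy product and derivation.

module Convolution (R : CommutativeRing c ℓ) where
  open CommutativeRing R hiding (zero)
  open SetoidReasoning setoid
  open CommutativeMonoidMult +-commutativeMonoid using (×-distrib-+)
  open SemiringMult semiring using (×-comm-*) renaming (_×_ to _·_)
  open RawMonoidDefs (CommutativeRing.+-rawMonoid R) using (sum)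
  open NaturalCoefficients commutativeSemiring using (solve; con; _:+_; _:*_; _:=_)

  conv : (f g : ℕ → Carrier) → ℕ → Carrier
  conv f g zero    = f 0 * g 0
  conv f g (suc n) = f 0 * g (suc n) + conv (f ∘ suc) g n

  weighted : (ℕ → Carrier) → ℕ → Carrier
  weighted f n = n · f n

  -- Agreement up to n is enough for the n-th coefficient. The bound matters because the recurrences
  -- for binomial coefficients are available only below p.
  conv-cong : ∀ {f f′ g g′} n → (∀ m → m ≤ n → f m ≈ f′ m) → (∀ m → m ≤ n → g m ≈ g′ m) →
              conv f g n ≈ conv f′ g′ n
  conv-cong zero    f≈f′ g≈g′ = *-cong (f≈f′ 0 z≤n) (g≈g′ 0 z≤n)
  conv-cong (suc n) f≈f′ g≈g′ =
    +-cong (*-cong (f≈f′ 0 z≤n) (g≈g′ (suc n) ℕₚ.≤-refl))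
      (conv-cong n (λ m m≤n → f≈f′ (suc m) (s≤s m≤n)) (λ m m≤n → g≈g′ m (ℕₚ.m≤n⇒m≤1+n m≤n)))

  sum≈conv : ∀ n f g (T : Fin (suc n) → Carrier) →
             (∀ k → T k ≈ f (toℕ k) * g (n ∸ toℕ k)) → sum T ≈ conv f g n
  sum≈conv zero    f g T eq = trans (+-identityʳ _) (eq zero)
  sum≈conv (suc n) f g T eq =
    +-cong (eq zero) (sum≈conv n (f ∘ suc) g (T ∘ suc) (eq ∘ suc))

  conv-suc : ∀ f g n → conv f g (suc n) ≈ conv f (g ∘ suc) n + f (suc n) * g 0
  conv-suc f g zero    = refl
  conv-suc f g (suc n) = trans (+-congˡ (conv-suc (f ∘ suc) g n)) (sym (+-assoc _ _ _))

  conv-comm : ∀ f g n → conv f g n ≈ conv g f n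
  conv-comm f g zero    = *-comm _ _
  conv-comm f g (suc n) = begin
    f 0 * g (suc n) + conv (f ∘ suc) g n    ≈⟨ +-cong (*-comm _ _) (conv-comm (f ∘ suc) g n) ⟩
    g (suc n) * f 0 + conv g (f ∘ suc) n    ≈⟨ +-comm _ _ ⟩
    conv g (f ∘ suc) n + g (suc n) * f 0    ≈⟨ conv-suc g f n ⟨
    conv g f (suc n)                        ∎

  conv-+ʳ : ∀ f g h n → conv f (λ m → g m + h m) n ≈ conv f g n + conv f h n
  conv-+ʳ f g h zero    = distribˡ _ _ _
  conv-+ʳ f g h (suc n) = trans (+-congˡ (conv-+ʳ (f ∘ suc) g h n)) (lemma (f 0) _ _ _ _)
    where
    lemma : ∀ a b c d e → a * (b + c) + (d + e) ≈ a * b + d + (a * c + e)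
    lemma = solve 5 (λ a b c d e → a :* (b :+ c) :+ (d :+ e) := a :* b :+ d :+ (a :* c :+ e)) refl

  conv-*ʳ : ∀ f a g n → conv f (λ m → a * g m) n ≈ a * conv f g n
  conv-*ʳ f a g zero    = lemma (f 0) a _
    where
    lemma : ∀ b a c → b * (a * c) ≈ a * (b * c)
    lemma = solve 3 (λ b a c → b :* (a :* c) := a :* (b :* c)) refl
  conv-*ʳ f a g (suc n) = trans (+-congˡ (conv-*ʳ (f ∘ suc) a g n)) (lemma (f 0) a _ _)
    where
    lemma : ∀ b a c d → b * (a * c) + a * d ≈ a * (b * c + d)
    lemma = solve 4 (λ b a c d → b :* (a :* c) :+ a :* d := a :* (b :* c :+ d)) refl

  -- Leibniz rule: multiplying the n-th term by n is the derivation X d/dX.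

  conv-weighted : ∀ f g n → conv (weighted f) g n + conv f (weighted g) n ≈ n · conv f g n
  conv-weighted f g zero    = lemma (f 0) (g 0)
    where
    lemma : ∀ a b → 0# * b + a * 0# ≈ 0#
    lemma = solve 2 (λ a b → con 0 :* b :+ a :* con 0 := con 0) refl
  conv-weighted f g (suc n) = begin
    (0# * g (suc n) + conv (λ m → suc m · f (suc m)) g n) + (f 0 * (suc n · g (suc n)) + conv f′ (weighted g) n)
      ≈⟨ +-cong (+-congˡ split) (+-congʳ (×-comm-* (suc n) (f 0) (g (suc n)))) ⟩
    (0# * g (suc n) + (F + conv (weighted f′) g n)) + (suc n · (f 0 * g (suc n)) + conv f′ (weighted g) n)
      ≈⟨ lemma (g (suc n)) F _ _ _ ⟩
    suc n · (f 0 * g (suc n)) + (F + (conv (weighted f′) g n + conv f′ (weighted g) n))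
      ≈⟨ +-congˡ (+-congˡ (conv-weighted f′ g n)) ⟩
    suc n · (f 0 * g (suc n)) + suc n · F
      ≈⟨ ×-distrib-+ _ _ (suc n) ⟨
    suc n · (f 0 * g (suc n) + F) ∎
    where
    f′ : ℕ → Carrier
    f′ = f ∘ suc

    F : Carrier
    F = conv f′ g n

    -- Shifting raises the weight by one: (m + 1) f (m + 1) = f′ m + m f′ m, and the extra summand
    -- contributes F.
    split : conv (λ m → suc m · f′ m) g n ≈ F + conv (weighted f′) g n
    split = begin
      conv (λ m → f′ m + m · f′ m) g n      ≈⟨ conv-comm _ g n ⟩
      conv g (λ m → f′ m + m · f′ m) n      ≈⟨ conv-+ʳ g f′ (weighted f′) n ⟩
      conv g f′ n + conv g (weighted f′) n  ≈⟨ +-cong (conv-comm g f′ n) (conv-comm g _ n) ⟩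
      F + conv (weighted f′) g n            ∎

    lemma : ∀ a b c d e → (0# * a + (b + c)) + (d + e) ≈ d + (b + (c + e))
    lemma = solve 5 (λ a b c d e → (con 0 :* a :+ (b :+ c)) :+ (d :+ e) := d :+ (b :+ (c :+ e))) refl

  -- In terms of generating functions: (1 + y X) g′ = w X g implies (1 + y X) (f g′) = w X (f g).

  conv-recurrence : ∀ f g g′ y w n → g′ 0 ≈ 0# →
    (∀ m → m ≤ n → g′ (suc m) + y * g′ m ≈ w * g m) →
    conv f g′ (suc n) + y * conv f g′ n ≈ w * conv f g n
  conv-recurrence f g g′ y w n g′₀ rec = begin
    conv f g′ (suc n) + y * conv f g′ n
      ≈⟨ +-congʳ (conv-suc f g′ n) ⟩
    conv f (g′ ∘ suc) n + f (suc n) * g′ 0 + y * conv f g′ n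
      ≈⟨ +-cong (trans (+-congˡ (trans (*-congˡ g′₀) (zeroʳ _))) (+-identityʳ _)) (sym (conv-*ʳ f y g′ n)) ⟩
    conv f (g′ ∘ suc) n + conv f (λ m → y * g′ m) n
      ≈⟨ conv-+ʳ f (g′ ∘ suc) (λ m → y * g′ m) n ⟨
    conv f (λ m → g′ (suc m) + y * g′ m) n
      ≈⟨ conv-cong n (λ _ _ → refl) rec ⟩
    conv f (λ m → w * g m) n
      ≈⟨ conv-*ʳ f w g n ⟩
    w * conv f g n ∎

-- Fermat's little theorem by the binomial theorem modulo p.

module Fermat (N : ℕ) (p-prime : Prime (suc N)) where
  private
    p : ℕ
    p = suc N
    module F = PrimeField p p-prime
  open CommutativeRing F.commutativeRing hiding (zero; _-_)
  open SemiringExp semiring using (_^_)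
  open MonoidSum +-monoid using (sum; sum-cong-≋; sum-replicate-zero; sum-init-last)
  open MonoidMult +-monoid using () renaming (_×_ to _·_)
  open SetoidReasoning setoid

  ·≡* : ∀ n x → n · x ≡ + n * x
  ·≡* zero    x = ≡.sym (ℤₚ.*-zeroˡ x)
  ·≡* (suc n) x = ≡.trans (≡.cong (ℤ._+_ x) (·≡* n x)) (≡.sym (ℤₚ.suc-* (+ n) x))

  p∣⇒·≈0 : ∀ {n} x → p ∣ n → n · x ≈ 0#
  p∣⇒·≈0 {n} x p∣n = begin
    n · x    ≡⟨ ·≡* n x ⟩
    + n * x  ≈⟨ *-congʳ {x} {+ n} {0#} (F.∣⇒≈0 p∣n) ⟩
    0# * x   ≈⟨ zeroˡ x ⟩
    0#       ∎

  -- In (p C k) k! (p - k)! = p! the prime divides the right-hand side but neither of the two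
  -- factorials.
  p∣pCk : ∀ {k} → 0 < k → k < p → p ∣ p C k
  p∣pCk {k} 0<k k<p = [ (λ d → d) , (λ d → ⊥-elim (p∤k![p∸k]! d)) ]′
    (euclidsLemma (p C k) (k ! ℕ.* (p ∸ k) !) p-prime
      (≡.subst (p ∣_) (≡.sym product) (m∣m*n (N !))))
    where
    instance _ = k ℕₚ.!* (p ∸ k) !≢0

    product : (p C k) ℕ.* (k ! ℕ.* (p ∸ k) !) ≡ p !
    product = ≡.trans
      (≡.cong (ℕ._* (k ! ℕ.* (p ∸ k) !)) (nCk≡n!/k![n-k]! (ℕₚ.<⇒≤ k<p)))
      (m/n*n≡m (k![n∸k]!∣n! (ℕₚ.<⇒≤ k<p)))

    p∤k![p∸k]! : p ∤ k ! ℕ.* (p ∸ k) !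
    p∤k![p∸k]! d = [ F.p∤! k<p , F.p∤! (ℕₚ.∸-monoʳ-< 0<k (ℕₚ.<⇒≤ k<p)) ]′
      (euclidsLemma (k !) ((p ∸ k) !) p-prime d)

  1^n≈1 : ∀ n → 1# ^ n ≈ 1#
  1^n≈1 zero    = refl
  1^n≈1 (suc n) = trans (*-identityˡ _) (1^n≈1 n)

  [1+x]^p≈1+x^p : ∀ x → (1# + x) ^ p ≈ 1# + x ^ p
  [1+x]^p≈1+x^p x = begin
    (1# + x) ^ p                            ≈⟨ theorem p 1# x ⟩
    t zero + sum (t ∘ suc)                  ≈⟨ +-cong first (sum-init-last (t ∘ suc)) ⟩
    x ^ p + (sum middle + t (suc (fromℕ N)))  ≈⟨ +-congˡ {x ^ p} (+-cong middle≈0 last) ⟩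
    x ^ p + (0# + 1#)                       ≈⟨ +-congˡ {x ^ p} (+-identityˡ 1#) ⟩
    x ^ p + 1#                              ≈⟨ +-comm (x ^ p) 1# ⟩
    1# + x ^ p                              ∎
    where
    open Binomial commutativeSemiring using (theorem; binomialTerm)
    t : Fin (suc p) → Carrier
    t = binomialTerm 1# x p

    middle : Fin N → Carrier
    middle i = t (suc (inject₁ i))

    first : t zero ≈ x ^ p
    first = trans (+-identityʳ _) (*-identityˡ _)

    middle≈0 : sum middle ≈ 0#
    middle≈0 = trans
      (sum-cong-≋ {N} {middle} {λ _ → 0#} λ i → p∣⇒·≈0 _
        (p∣pCk (s≤s z≤n) (s≤s (≡.subst (_< N) (≡.sym (toℕ-inject₁ i)) (toℕ<n i)))))
      (sum-replicate-zero N)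

    last : t (suc (fromℕ N)) ≈ 1#
    last = begin
      t (suc (fromℕ N))                ≡⟨ ≡.cong (λ k → (p C suc k) · (1# ^ suc k * x ^ (N ∸ k))) (toℕ-fromℕ N) ⟩
      (p C p) · (1# ^ p * x ^ (N ∸ N))   ≡⟨ ≡.cong₂ (λ c e → c · (1# ^ p * x ^ e)) (nCn≡1 p) (ℕₚ.n∸n≡0 N) ⟩
      1# ^ p * 1# + 0#                 ≈⟨ +-identityʳ _ ⟩
      1# ^ p * 1#                      ≈⟨ *-identityʳ _ ⟩
      1# ^ p                           ≈⟨ 1^n≈1 p ⟩
      1#                               ∎

  n^p≈n : ∀ n → (+ n) ^ p ≈ + n
  n^p≈n zero    = zeroˡ (0# ^ N)
  n^p≈n (suc n) = trans ([1+x]^p≈1+x^p (+ n)) (+-congˡ {1#} {(+ n) ^ p} {+ n} (n^p≈n n))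

  n^[p-1]≈1 : ∀ n → p ∤ n → (+ n) ^ N ≈ 1#
  n^[p-1]≈1 n p∤n = begin
    (+ n) ^ N                    ≈⟨ *-identityˡ _ ⟨
    1# * (+ n) ^ N               ≈⟨ *-congʳ {(+ n) ^ N} (proj₂ (F.inverse n p∤n)) ⟨
    (+ n * x) * (+ n) ^ N        ≡⟨ lemma (+ n) x ((+ n) ^ N) ⟩
    x * (+ n) ^ p                ≈⟨ *-congˡ {x} (n^p≈n n) ⟩
    x * + n                      ≈⟨ *-comm x (+ n) ⟩
    + n * x                      ≈⟨ proj₂ (F.inverse n p∤n) ⟩
    1#                           ∎
    where
    x : ℤ
    x = proj₁ (F.inverse n p∤n)
    lemma : ∀ a b c → (a ℤ.* b) ℤ.* c ≡ b ℤ.* (a ℤ.* c)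
    lemma = solve-∀

-- Inverting α^(p-1) - 1: divisors of its powers and membership in the subring.

module Localisation (N : ℕ) (p-prime : Prime (suc N)) where
  private
    p : ℕ
    p = suc N
  open TruncatedLogarithm p p-prime
  open 𝔽ₚ[α] renaming (_≈_ to _≈ₚ_)
  private
    module F = PrimeField p p-prime
    module 𝔽 = CommutativeRing 𝔽ₚ
    module Q = 𝔽ₚ⟨α⟩
  open CommutativeRing (PolynomialRing.commutativeRing 𝔽ₚ) public
    using ()
    renaming ( refl to reflₚ; sym to symₚ; trans to transₚ; setoid to setoidₚ
             ; *-cong to *-congₚ; *-congˡ to *-congˡₚ; *-congʳ to *-congʳₚ
             ; zeroˡ to zeroˡₚ; zeroʳ to zeroʳₚ; *-identityˡ to *-identityˡₚ
             ; *-identityʳ to *-identityʳₚ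
             ; semiring to semiringₚ; commutativeSemiring to commutativeSemiringₚ)
  open SemiringExp semiringₚ using (^-homo-*)
  open Evaluation 𝔽ₚ
  open NaturalCoefficients commutativeSemiringₚ using (solve; con; _:+_; _:*_; _:=_)

  w : Poly
  w = α ^ N - 1#

  w≉0 : w ≉ 0#
  w≉0 = αᵖ⁻¹-1≉0

  w^n≉0 : ∀ n → w ^ n ≉ 0#
  w^n≉0 zero    = 1≉0
  w^n≉0 (suc n) = *-nonzero w≉0 (w^n≉0 n)

  -- Invertibility of f after inverting `w`, with a witness: the reciprocal of f is `cofactor` over
  -- `w ^ exponent`. Powers are needed because the factors b of one denominator may share roots,
  -- while `w` has only simple ones.
  record DividesPower (f : Poly) : Set where
    constructor dividesPower
    field
      exponent   : ℕ
      cofactor   : Poly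
      f*cofactor : f * cofactor ≈ₚ w ^ exponent

  dividesPower-resp : ∀ {f g} → f ≈ₚ g → DividesPower f → DividesPower g
  dividesPower-resp f≈g (dividesPower n h fh≈) =
    dividesPower n h (transₚ (*-congʳₚ {h} (symₚ f≈g)) fh≈)

  1-dividesPower : DividesPower 1#
  1-dividesPower = dividesPower 0 1# (*-identityˡₚ 1#)

  *-dividesPower : ∀ {f g} → DividesPower f → DividesPower g → DividesPower (f * g)
  *-dividesPower {f} {g} (dividesPower m f′ ff′≈) (dividesPower n g′ gg′≈) = dividesPower (m ℕ.+ n) (f′ * g′) (begin
    (f * g) * (f′ * g′)  ≈⟨ solve 4 (λ a b c d → (a :* b) :* (c :* d) := (a :* c) :* (b :* d)) reflₚ f g f′ g′ ⟩
    (f * f′) * (g * g′)  ≈⟨ *-congₚ ff′≈ gg′≈ ⟩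
    w ^ m * w ^ n        ≈⟨ ^-homo-* w m n ⟨
    w ^ (m ℕ.+ n)        ∎)
    where open SetoidReasoning setoidₚ

  ∏-dividesPower : ∀ {n} (f : Fin n → Poly) → (∀ i → DividesPower (f i)) → DividesPower (∏ f)
  ∏-dividesPower {zero}  f f∣ = 1-dividesPower
  ∏-dividesPower {suc n} f f∣ = *-dividesPower (f∣ zero) (∏-dividesPower (f ∘ suc) (f∣ ∘ suc))

  -- Since 𝔽ₚ[α] has no zero divisors, no power of `w` is 0, and so neither is a divisor of one.
  -- This makes divisibility serve twice: for the nonvanishing that `G` requires and for membership
  -- of the reciprocal.
  dividesPower⇒≉0 : ∀ {f} → DividesPower f → f ≉ 0#
  dividesPower⇒≉0 {f} (dividesPower n g fg≈) f≈0 =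
    w^n≉0 n (transₚ (symₚ fg≈) (transₚ (*-congʳₚ {g} f≈0) (zeroˡₚ g)))

  unit : ∀ a → ¬ (a 𝔽.≈ 0ℤ) → ∃ λ x → a ℤ.* x 𝔽.≈ 1ℤ
  unit (+ n)      a≉0 = F.inverse n λ p∣n → a≉0 (F.∣⇒≈0 p∣n)
  unit (-[1+ n ]) a≉0 with F.inverse (suc n) (λ p∣n → a≉0 (F.∣⇒≈0 p∣n))
  ... | x , eq = ℤ.- x , 𝔽.trans (𝔽.reflexive (lemma (+ suc n) x)) eq
    where
    lemma : ∀ a x → (ℤ.- a) ℤ.* (ℤ.- x) ≡ a ℤ.* x
    lemma = solve-∀

  constant-dividesPower : ∀ f → (∀ n → 0 < n → coeff f n 𝔽.≈ 0ℤ) → f ≉ 0# → DividesPower f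
  constant-dividesPower f deg f≉0 = dividesPower 0 (constant x)
    (transₚ (*-congʳₚ {constant x} f≈a)
      (coeffwise λ { zero → 𝔽.trans (𝔽.reflexive (ℤₚ.+-identityʳ _)) ax≈1 ; (suc n) → 𝔽.refl }))
    where
    a : ℤ
    a = coeff f 0

    f≈a : f ≈ₚ constant a
    f≈a = coeffwise λ { zero → 𝔽.refl ; (suc n) → deg (suc n) (s≤s z≤n) }

    inv : ∃ λ x → a ℤ.* x 𝔽.≈ 1ℤ
    inv = unit a λ a≈0 → f≉0 (coeffwise λ { zero → a≈0 ; (suc n) → deg (suc n) (s≤s z≤n) })

    x : ℤ
    x = proj₁ inv

    ax≈1 : a ℤ.* x 𝔽.≈ 1ℤ
    ax≈1 = proj₂ inv

  eval-α^ : ∀ x n → eval x (α ^ n) 𝔽.≈ SemiringExp._^_ 𝔽.semiring x n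
  eval-α^ x zero    = eval-constant x 1ℤ
  eval-α^ x (suc n) = 𝔽.trans (eval-* x α (α ^ n))
    (𝔽.*-cong {eval x α} {x} {eval x (α ^ n)} (eval-X x) (eval-α^ x n))

  α-n-dividesPower : ∀ n → p ∤ n → DividesPower (α - constant (+ n))
  α-n-dividesPower n p∤n = dividesPower 1 (quotient (+ n) w)
    (transₚ (symₚ (quotient-root (+ n) w w[n]≈0)) (symₚ (*-identityʳₚ w)))
    where
    w[n]≈0 : eval (+ n) w 𝔽.≈ 0ℤ
    w[n]≈0 = begin
      eval (+ n) w                                   ≈⟨ eval-+ (+ n) (α ^ N) (- 1#) ⟩
      eval (+ n) (α ^ N) ℤ.+ eval (+ n) (- 1#)
        ≈⟨ 𝔽.+-cong (𝔽.trans (eval-α^ (+ n) N) (Fermat.n^[p-1]≈1 N p-prime n p∤n))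
             (𝔽.trans (eval-neg (+ n) 1#) (𝔽.-‿cong (eval-constant (+ n) 1ℤ))) ⟩
      1ℤ ℤ.+ ℤ.- 1ℤ                                  ∎
      where open SetoidReasoning 𝔽.setoid

  -- Horner division splits off one root at a time. The other points stay roots of the quotient
  -- because the linear factor is nonzero at them, by distinctness. After d divisions a nonzero
  -- constant is left, which is a unit; each linear factor divides `w`.
  splits-dividesPower : ∀ d (r : ℕ → ℕ) →
    (∀ i → i < d → p ∤ r i) →
    (∀ i j → i < j → j < d → ¬ (+ r i 𝔽.≈ + r j)) →
    ∀ f → f ≉ 0# → (∀ n → d < n → coeff f n 𝔽.≈ 0ℤ) →
    (∀ i → i < d → eval (+ r i) f 𝔽.≈ 0ℤ) → DividesPower f
  splits-dividesPower zero    r r≉0 r-distinct f f≉0 deg root = constant-dividesPower f deg f≉0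
  splits-dividesPower (suc d) r r≉0 r-distinct f f≉0 deg root =
    dividesPower-resp (symₚ f≈lq) (*-dividesPower (α-n-dividesPower (r d) (r≉0 d (ℕₚ.n<1+n d)))
      (splits-dividesPower d r (λ i i<d → r≉0 i (ℕₚ.m<n⇒m<1+n i<d))
        (λ i j i<j j<d → r-distinct i j i<j (ℕₚ.m<n⇒m<1+n j<d)) q q≉0
        (quotient-degree (+ r d) f d deg) q-root))
    where
    q : Poly
    q = quotient (+ r d) f

    l : Poly
    l = α - constant (+ r d)

    f≈lq : f ≈ₚ l * q
    f≈lq = quotient-root (+ r d) f (root d (ℕₚ.n<1+n d))

    q≉0 : q ≉ 0#
    q≉0 q≈0 = f≉0 (transₚ f≈lq (transₚ (*-congˡₚ {l} q≈0) (zeroʳₚ l)))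

    q-root : ∀ i → i < d → eval (+ r i) q 𝔽.≈ 0ℤ
    q-root i i<d = [ (λ z → ⊥-elim (r-distinct i d i<d (ℕₚ.n<1+n d) (r≈ z))) , (λ z → z) ]′
      (F.noZeroDivisors {eval (+ r i) l} {eval (+ r i) q}
        (𝔽.trans (𝔽.sym (eval-* (+ r i) l q))
          (𝔽.trans (𝔽.sym (eval-cong (+ r i) f (l * q) f≈lq)) (root i (ℕₚ.m<n⇒m<1+n i<d)))))
      where
      r≈ : eval (+ r i) l 𝔽.≈ 0ℤ → + r i 𝔽.≈ + r d
      r≈ z = F.congruent (≡.subst (_ ℤ∣.∣_) (ℤₚ.+-identityʳ _) (F.p∣x-y (𝔽.trans (𝔽.sym eval-l) z)))
        where
        eval-l : eval (+ r i) l 𝔽.≈ + r i ℤ.- + r d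
        eval-l = 𝔽.trans (eval-+ (+ r i) α (- constant (+ r d)))
          (𝔽.+-cong {eval (+ r i) α} {+ r i} (eval-X (+ r i))
            (𝔽.trans (eval-neg (+ r i) (constant (+ r d)))
              (𝔽.-‿cong (eval-constant (+ r i) (+ r d)))))

  private
    Member : Q.Frac → Set
    Member = 𝔽ₚ[α,1/αᵖ⁻¹-1]

  embed-member : ∀ f → Member (Q.embed f)
  embed-member []      = resp (Q.cross (coeffwise λ { zero → 𝔽.refl ; (suc n) → 𝔽.refl }))
      (gen (scalar 0ℤ))
  embed-member (a ∷ f) = resp
    -- Fractions are never reduced, so the member built from generators has denominator 1 * (1 * 1),
    -- and cross multiplication has to clear it.
    (Q.cross (begin
      (constant a * (1# * 1#) + (α * f) * 1#) * 1#
        ≈⟨ solve 3 (λ a x f → (a :* (con 1 :* con 1) :+ (x :* f) :* con 1) :* con 1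
                     := (a :+ x :* f) :* (con 1 :* (con 1 :* con 1))) reflₚ (constant a) α f ⟩
      (constant a + α * f) * (1# * (1# * 1#))
        ≈⟨ *-congʳₚ {1# * (1# * 1#)} a+αf≈ ⟩
      (a ∷ f) * (1# * (1# * 1#)) ∎))
    (add (gen (scalar a)) (mul (gen indeterminate) (embed-member f)))
    where
    open SetoidReasoning setoidₚ
    a+αf≈ : constant a + α * f ≈ₚ a ∷ f
    a+αf≈ = coeffwise λ
      { zero → 𝔽.trans (PolynomialProperties.coeff-+ 𝔽ₚ (constant a) (α * f) 0)
          (𝔽.trans (𝔽.+-congˡ {a} (𝔽.trans (PolynomialProperties.coeff-*-zero 𝔽ₚ α f) (𝔽.zeroˡ (coeff f 0))))
            (𝔽.+-identityʳ a))
      ; (suc n) → 𝔽.trans (PolynomialProperties.coeff-+ 𝔽ₚ (constant a) (α * f) (suc n))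
          (𝔽.trans (𝔽.+-identityˡ _)
            (𝔽.trans (coeff-linear-* 0ℤ 1ℤ f n)
              (𝔽.reflexive (lemma (coeff f (suc n)) (coeff f n)))))
      }
      where
      lemma : ∀ x y → 0ℤ ℤ.* x ℤ.+ 1ℤ ℤ.* y ≡ y
      lemma = solve-∀

  reciprocal-power-member : ∀ n → Member (Q.reciprocal (w ^ n) (w^n≉0 n))
  reciprocal-power-member zero    = resp (Q.cross reflₚ) one
  reciprocal-power-member (suc n) = resp
    (Q.cross (*-congʳₚ {w * w ^ n} (*-identityˡₚ 1#)))
    (mul (gen [αᵖ⁻¹-1]⁻¹) (reciprocal-power-member n))

  reciprocal-member : ∀ {f} → DividesPower f → (f≉0 : f ≉ 0#) → Member (Q.reciprocal f f≉0)
  reciprocal-member {f} (dividesPower n g fg≈) f≉0 = resp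
    (Q.cross (begin
      (g * 1#) * f      ≈⟨ solve 2 (λ g f → (g :* con 1) :* f := f :* g) reflₚ g f ⟩
      f * g             ≈⟨ fg≈ ⟩
      w ^ n             ≈⟨ solve 1 (λ x → x := con 1 :* (con 1 :* x)) reflₚ (w ^ n) ⟩
      1# * (1# * w ^ n)  ∎))
    (mul (embed-member g) (reciprocal-power-member n))
    where open SetoidReasoning setoidₚ

  module X = 𝔽ₚ⟨α⟩[X]

  Members : X.Poly → Set
  Members f = ∀ n → Member (X.coeff f n)

  0-member : Member (Q.embed 0#)
  0-member = embed-member []

  +-members : ∀ f g → Members f → Members g → Members (f X.+ g)
  +-members []      g       f∈ g∈ n       = g∈ n
  +-members (a ∷ f) []      f∈ g∈ n       = f∈ n
  +-members (a ∷ f) (b ∷ g) f∈ g∈ zero    = add (f∈ 0) (g∈ 0)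
  +-members (a ∷ f) (b ∷ g) f∈ g∈ (suc n) = +-members f g (f∈ ∘ suc) (g∈ ∘ suc) n

  neg-members : ∀ f → Members f → Members (X.- f)
  neg-members []      f∈ n       = 0-member
  neg-members (a ∷ f) f∈ zero    = neg (f∈ 0)
  neg-members (a ∷ f) f∈ (suc n) = neg-members f (f∈ ∘ suc) n

  monomial-members : ∀ m {a} → Member a → Members (X.monomial m a)
  monomial-members zero    a∈ zero    = a∈
  monomial-members zero    a∈ (suc n) = 0-member
  monomial-members (suc m) a∈ zero    = 0-member
  monomial-members (suc m) a∈ (suc n) = monomial-members m a∈ n

  ∑-members : ∀ {n} (f : Fin n → X.Poly) → (∀ i → Members (f i)) → Members (X.∑ f)
  ∑-members {zero}  f f∈ n = 0-member
  ∑-members {suc n} f f∈ =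
    +-members (f zero) (X.∑ (f ∘ suc)) (f∈ zero) (∑-members (f ∘ suc) (f∈ ∘ suc))

  G-members : (∀ j → DividesPower (denominator j)) → ∀ ≉0 → Members (G ≉0)
  G-members denominator∣ ≉0 = neg-members (X.∑ term) (∑-members term λ j →
    monomial-members (suc (toℕ j))
      (mul (gen (scalar (inv j))) (reciprocal-member (denominator∣ j) (≉0 j))))
    where
    inv : Fin N → ℤ
    inv j = 1/ (suc (toℕ j)) (p∤ (s≤s z≤n) (1+toℕ<p j))

    term : Fin N → X.Poly
    term j = X.monomial (suc (toℕ j))
      (Q.embed (constant (inv j)) Q.* Q.reciprocal (denominator j) (≉0 j))

-- Degree and leading coefficient from the recurrences.

module Recurrence (N : ℕ) (p-prime : Prime (suc N)) where
  private
    p : ℕ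
    p = suc N
    module F = PrimeField p p-prime
    module 𝔽 = CommutativeRing F.commutativeRing
  open F using (_≈_)
  open import Data.Integer.Base using (_+_; _*_; _-_; -_)
  open SetoidReasoning 𝔽.setoid

  cancel : ∀ {n} a → p ∤ n → + n * a ≈ 0ℤ → a ≈ 0ℤ
  cancel {n} a p∤n na≈0 = [ (λ n≈0 → ⊥-elim (p∤n (F.≈0⇒∣ n≈0))) , (λ a≈0 → a≈0) ]′
    (F.noZeroDivisors {+ n} {a} na≈0)

  private
    *0 : ∀ a {b} → b ≈ 0ℤ → a * b ≈ 0ℤ
    *0 a {b} b≈0 = 𝔽.trans (𝔽.*-congˡ {a} b≈0) (𝔽.zeroʳ a)

    0+ : ∀ {a b} → a ≈ 0ℤ → a + b ≈ b
    0+ {a} {b} a≈0 = 𝔽.trans (𝔽.+-congʳ {b} a≈0) (𝔽.+-identityˡ b)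

    +0 : ∀ {a b} → b ≈ 0ℤ → a + b ≈ a
    +0 {a} {b} b≈0 = 𝔽.trans (𝔽.+-congˡ {a} b≈0) (𝔽.+-identityʳ a)

  -- F n k, P n k and Q n k stand for the coefficients of α^k in the n-th terms of the series and of
  -- its two partial derivatives, one for each factor. The -1 and 1 in `P-suc` are the coefficients
  -- of α - 1; in `F-suc` the factor on the right is already free of α.
  module _
    (x : ℤ) (x≉1 : ¬ (x ≈ 1ℤ))
    (F P Q : ℕ → ℕ → ℤ)
    (F₀₀ : F 0 0 ≈ 1ℤ)
    (F₀ : ∀ k → F 0 (suc k) ≈ 0ℤ)
    (P₀ : ∀ k → P 0 k ≈ 0ℤ)
    (Q+P : ∀ n k → Q n k + P n k ≈ + n * F n k)
    (P-suc : ∀ n k → n < N → P (suc n) (suc k) + P n (suc k) ≈ -1ℤ * F n (suc k) + 1ℤ * F n k)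
    (F-suc : ∀ n k → n < N →
             + suc n * F (suc n) k + (P n k + x * Q n k) ≈ (-1ℤ + - x) * F n k)
    where

    Q≈0 : ∀ n k → F n k ≈ 0ℤ → P n k ≈ 0ℤ → Q n k ≈ 0ℤ
    Q≈0 n k Fₙₖ Pₙₖ = 𝔽.trans (𝔽.sym (+0 {Q n k} Pₙₖ)) (𝔽.trans (Q+P n k) (*0 (+ n) Fₙₖ))

    -- The two bounds feed each other. By `F-suc`, passing to n + 1 gives F at most the larger
    -- degree of F and P at n; by `P-suc`, it gives P at most the degree of P at n or one more than
    -- that of F at n. Hence F gains at most one degree in two steps. Comparing with `k ℕ.+ k`
    -- avoids halving.
    vanish : ∀ n → n ≤ N → (∀ k → n < k ℕ.+ k → F n k ≈ 0ℤ) × (∀ k → suc n < k ℕ.+ k → P n k ≈ 0ℤ)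
    vanish zero    n≤N = (λ { (suc k) _ → F₀ k }) , λ k _ → P₀ k
    vanish (suc n) n<N = Fₙ₊₁ , Pₙ₊₁
      where
      Fₙ : ∀ k → n < k ℕ.+ k → F n k ≈ 0ℤ
      Fₙ = proj₁ (vanish n (ℕₚ.<⇒≤ n<N))

      Pₙ : ∀ k → suc n < k ℕ.+ k → P n k ≈ 0ℤ
      Pₙ = proj₂ (vanish n (ℕₚ.<⇒≤ n<N))

      Fₙ₊₁ : ∀ k → suc n < k ℕ.+ k → F (suc n) k ≈ 0ℤ
      -- The factor n + 1 may be cancelled because n < N keeps it below p.
      Fₙ₊₁ k n+1<2k = cancel (F (suc n) k) (F.p∤ (s≤s z≤n) (s≤s n<N)) (begin
        + suc n * F (suc n) k
          ≈⟨ +0 {+ suc n * F (suc n) k} (𝔽.trans (0+ {P n k} Pₙₖ) (*0 x (Q≈0 n k Fₙₖ Pₙₖ))) ⟨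
        + suc n * F (suc n) k + (P n k + x * Q n k)
          ≈⟨ F-suc n k n<N ⟩
        (-1ℤ + - x) * F n k
          ≈⟨ *0 (-1ℤ + - x) Fₙₖ ⟩
        0ℤ ∎)
        where
        Fₙₖ : F n k ≈ 0ℤ
        Fₙₖ = Fₙ k (ℕₚ.<-trans (ℕₚ.n<1+n n) n+1<2k)
        Pₙₖ : P n k ≈ 0ℤ
        Pₙₖ = Pₙ k n+1<2k

      Pₙ₊₁ : ∀ k → suc (suc n) < k ℕ.+ k → P (suc n) k ≈ 0ℤ
      Pₙ₊₁ (suc k) (s≤s n+1<k+[1+k]) = begin
        P (suc n) (suc k)                      ≈⟨ +0 {P (suc n) (suc k)} (Pₙ (suc k) n+1<2+2k) ⟨
        P (suc n) (suc k) + P n (suc k)        ≈⟨ P-suc n k n<N ⟩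
        -1ℤ * F n (suc k) + 1ℤ * F n k
          ≈⟨ +0 {_} {1ℤ * F n k} (*0 1ℤ (Fₙ k (ℕ.s≤s⁻¹ (≡.subst (suc n <_) (ℕₚ.+-suc k k) n+1<k+[1+k])))) ⟩
        -1ℤ * F n (suc k)                      ≈⟨ *0 -1ℤ (Fₙ (suc k) (ℕₚ.<-trans (ℕₚ.n<1+n n) n+1<2+2k)) ⟩
        0ℤ                                     ∎
        where
        n+1<2+2k : suc n < suc k ℕ.+ suc k
        n+1<2+2k = ℕₚ.<-trans n+1<k+[1+k] (ℕₚ.n<1+n _)

    degree : ∀ n → n ≤ N → ∀ k → n < k ℕ.+ k → F n k ≈ 0ℤ
    degree n n≤N = proj₁ (vanish n n≤N)

    -- The top coefficients in `P-suc` at 2m and in `F-suc` at 2m + 1 combine to (2m + 2) F (2m + 2)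
    -- (m + 1) = (x - 1) F (2m) m. Starting from F 0 0 = 1, the leading coefficient therefore
    -- survives as long as x is not 1.
    leading≉0 : ∀ m → m ℕ.+ m ≤ N → ¬ (F (m ℕ.+ m) m ≈ 0ℤ)
    leading≉0 zero    _ F₀₀≈0 = F.1≉0 (𝔽.trans (𝔽.sym F₀₀) F₀₀≈0)
    leading≉0 (suc m) 2m+2≤N Fₙ₊₁≈0 =
      [ (λ x-1≈0 → x≉1 (𝔽.trans (𝔽.reflexive (≡.sym (sub-add x))) (0+ {x - 1ℤ} {1ℤ} x-1≈0)))
      , leading≉0 m (ℕₚ.<⇒≤ 2m<N) ]′
        (F.noZeroDivisors {x - 1ℤ} {F 2m m} (begin
          (x - 1ℤ) * F 2m m                ≈⟨ 𝔽.*-congˡ {x - 1ℤ} P≈F ⟨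
          (x - 1ℤ) * P n (suc m)           ≡⟨ lemma x (P n (suc m)) ⟩
          - (P n (suc m) + x * - P n (suc m))  ≈⟨ 𝔽.-‿cong (𝔽.+-congˡ {P n (suc m)} (𝔽.*-congˡ {x} Q≈-P)) ⟨
          - (P n (suc m) + x * Q n (suc m))    ≈⟨ 𝔽.-‿cong P+xQ≈0 ⟩
          0ℤ                               ∎))
      where
      2m n : ℕ
      2m = m ℕ.+ m
      n  = suc 2m

      2+2m≡ : suc m ℕ.+ suc m ≡ suc n
      2+2m≡ = ≡.cong suc (ℕₚ.+-suc m m)

      n<N : n < N
      n<N = ≡.subst (_≤ N) 2+2m≡ 2m+2≤N

      2m<N : 2m < N
      2m<N = ℕₚ.<⇒≤ n<N

      n<2+2m : n < suc m ℕ.+ suc m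
      n<2+2m = ≡.subst (n <_) (≡.sym 2+2m≡) (ℕₚ.n<1+n n)

      Fₙ≈0 : F n (suc m) ≈ 0ℤ
      Fₙ≈0 = degree n (ℕₚ.<⇒≤ n<N) (suc m) n<2+2m

      P≈F : P n (suc m) ≈ F 2m m
      P≈F = begin
        P n (suc m)
          ≈⟨ +0 {P n (suc m)} (proj₂ (vanish 2m (ℕₚ.<⇒≤ 2m<N)) (suc m) n<2+2m) ⟨
        P n (suc m) + P 2m (suc m)
          ≈⟨ P-suc 2m m 2m<N ⟩
        -1ℤ * F 2m (suc m) + 1ℤ * F 2m m
          ≈⟨ 0+ { -1ℤ * F 2m (suc m)} (*0 -1ℤ (degree 2m (ℕₚ.<⇒≤ 2m<N) (suc m) (ℕₚ.<-trans (ℕₚ.n<1+n 2m) n<2+2m))) ⟩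
        1ℤ * F 2m m
          ≡⟨ ℤₚ.*-identityˡ (F 2m m) ⟩
        F 2m m ∎

      Q≈-P : Q n (suc m) ≈ - P n (suc m)
      Q≈-P = begin
        Q n (suc m)                                ≡⟨ add-sub (Q n (suc m)) (P n (suc m)) ⟩
        Q n (suc m) + P n (suc m) + - P n (suc m)  ≈⟨ 0+ {Q n (suc m) + P n (suc m)} (𝔽.trans (Q+P n (suc m)) (*0 (+ n) Fₙ≈0)) ⟩
        - P n (suc m)                              ∎
        where
        add-sub : ∀ a b → a ≡ a + b + - b
        add-sub = solve-∀

      P+xQ≈0 : P n (suc m) + x * Q n (suc m) ≈ 0ℤ
      P+xQ≈0 = begin
        P n (suc m) + x * Q n (suc m)
          ≈⟨ 0+ {+ suc n * F (suc n) (suc m)} (*0 (+ suc n) (≡.subst (λ l → F l (suc m) ≈ 0ℤ) 2+2m≡ Fₙ₊₁≈0)) ⟨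
        + suc n * F (suc n) (suc m) + (P n (suc m) + x * Q n (suc m))
          ≈⟨ F-suc n (suc m) n<N ⟩
        (-1ℤ + - x) * F n (suc m)
          ≈⟨ *0 (-1ℤ + - x) Fₙ≈0 ⟩
        0ℤ ∎

      sub-add : ∀ a → a - 1ℤ + 1ℤ ≡ a
      sub-add = solve-∀

      lemma : ∀ a b → (a - 1ℤ) * b ≡ - (b + a * - b)
      lemma = solve-∀

-- A root from each pair of classes ±j.

module Roots (N : ℕ) (p-prime : Prime (suc N)) (s : ℕ) (p∤s : suc N ∤ s) where
  private
    p : ℕ
    p = suc N
    module F = PrimeField p p-prime
    module 𝔽 = CommutativeRing F.commutativeRing
  open F using (_≈_)
  open import Data.Integer.Base using (_+_; _*_; _-_; -_)
  open SetoidReasoning 𝔽.setoid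

  residue : ℕ → ℕ
  residue j = (s ℕ.* j) % p

  -- Of the two classes ±j, the one for which a and s a have residues with sum at most p.

  root : ℕ → ℕ
  root j with j ℕ.+ residue j ℕₚ.≤? p
  ... | yes _ = j
  ... | no  _ = p ∸ j

  p≈0 : + p ≈ 0ℤ
  p≈0 = F.∣⇒≈0 ∣-refl

  private
    ≈-+p : ∀ a b c → a ℕ.+ b ≡ p → + c ≈ + b → - (+ c) ≈ + a
    ≈-+p a b c a+b≡p c≈b = begin
      - (+ c)              ≈⟨ 𝔽.-‿cong c≈b ⟩
      - (+ b)              ≡⟨ lemma (+ a) (+ b) ⟩
      + a - (+ a + + b)    ≡⟨ ≡.cong (λ z → + a - z) (≡.sym (ℤₚ.pos-+ a b)) ⟩
      + a - + (a ℕ.+ b)    ≡⟨ ≡.cong (λ z → + a - + z) a+b≡p ⟩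
      + a - + p            ≈⟨ 𝔽.+-congˡ {+ a} (𝔽.-‿cong p≈0) ⟩
      + a + 0ℤ             ≡⟨ ℤₚ.+-identityʳ (+ a) ⟩
      + a                  ∎
      where
      lemma : ∀ a b → - b ≡ a - (a + b)
      lemma = solve-∀

  module _ {j : ℕ} (0<j : 0 < j) (j<p : j < p) where

    sj≈residue : + (s ℕ.* j) ≈ + residue j
    sj≈residue = begin
      + (s ℕ.* j)                                  ≡⟨ ≡.cong +_ (m≡m%n+[m/n]*n (s ℕ.* j) p) ⟩
      + (residue j ℕ.+ (s ℕ.* j) / p ℕ.* p)        ≡⟨ ℤₚ.pos-+ (residue j) _ ⟩
      + residue j + + ((s ℕ.* j) / p ℕ.* p)        ≈⟨ 𝔽.+-congˡ {+ residue j} {+ ((s ℕ.* j) / p ℕ.* p)} {0ℤ} (F.∣⇒≈0 (n∣m*n ((s ℕ.* j) / p))) ⟩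
      + residue j + 0ℤ                             ≡⟨ ℤₚ.+-identityʳ _ ⟩
      + residue j                                  ∎

    residue-positive : 0 < residue j
    residue-positive = ℕₚ.n≢0⇒n>0 λ r≡0 →
      [ p∤s , F.p∤ 0<j j<p ]′ (euclidsLemma s j p-prime (m%n≡0⇒n∣m (s ℕ.* j) p r≡0))

    -- A and B are the values of α - 1 and sα - 1 at a, as natural numbers. When A + B < N, every k
    -- satisfies A < N - k or B < k, so one of the two binomials in the k-th summand of b contains a
    -- zero factor. The field `a≈±j` is what distinctness of the roots is read from.
    record IsRoot (a : ℕ) : Set where
      field
        A B   : ℕ
        a≡    : a ≡ suc A
        sa≈   : + s * + a ≈ + suc B
        A+B<N : A ℕ.+ B < N
        a≈±j  : + a ≈ + j ⊎ + a ≈ - (+ j)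

    root-isRoot : IsRoot (root j)
    root-isRoot with j ℕ.+ residue j ℕₚ.≤? p
    ... | yes j+r≤p = record
      { A = ℕ.pred j
      ; B = ℕ.pred (residue j)
      ; a≡ = j≡
      ; sa≈ = 𝔽.trans (𝔽.reflexive (≡.sym (ℤₚ.pos-* s j)))
                (≡.subst (λ r → + (s ℕ.* j) ≈ + r) r≡ sj≈residue)
      ; A+B<N = ≡.subst (_≤ N) (ℕₚ.+-suc (ℕ.pred j) _)
          (ℕ.s≤s⁻¹ (≡.subst₂ (λ a b → a ℕ.+ b ≤ p) j≡ r≡ j+r≤p))
      ; a≈±j = inj₁ 𝔽.refl
      }
      where
      j≡ : j ≡ suc (ℕ.pred j)
      j≡ = ≡.sym (ℕₚ.suc-pred j ⦃ ℕ.>-nonZero 0<j ⦄)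
      r≡ : residue j ≡ suc (ℕ.pred (residue j))
      r≡ = ≡.sym (ℕₚ.suc-pred (residue j) ⦃ ℕ.>-nonZero residue-positive ⦄)
    ... | no j+r≰p = record
      { A = A
      ; B = B
      ; a≡ = a≡
      ; sa≈ = begin
          + s * + (p ∸ j)          ≈⟨ 𝔽.*-congˡ {+ s} (𝔽.sym (≈-+p (p ∸ j) j j a+j≡p 𝔽.refl)) ⟩
          + s * - (+ j)            ≡⟨ ℤₚ.neg-distribʳ-* (+ s) (+ j) ⟨
          - (+ s * + j)            ≡⟨ ≡.cong -_ (ℤₚ.pos-* s j) ⟨
          - (+ (s ℕ.* j))          ≈⟨ ≈-+p (suc B) (residue j) (s ℕ.* j) b+r≡p sj≈residue ⟩
          + suc B                  ∎
      ; A+B<N = ≡.subst (_≤ N) (ℕₚ.+-suc A B) (ℕ.s≤s⁻¹ (ℕₚ.<⇒≤ A+B+2<p))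
      ; a≈±j = inj₂ (𝔽.sym (≈-+p (p ∸ j) j j a+j≡p 𝔽.refl))
      }
      where
      A B : ℕ
      A = ℕ.pred (p ∸ j)
      B = ℕ.pred (p ∸ residue j)

      a≡ : p ∸ j ≡ suc A
      a≡ = ≡.sym (ℕₚ.suc-pred (p ∸ j) ⦃ ℕ.>-nonZero (ℕₚ.m<n⇒0<n∸m j<p) ⦄)

      b≡ : p ∸ residue j ≡ suc B
      b≡ = ≡.sym (ℕₚ.suc-pred (p ∸ residue j) ⦃ ℕ.>-nonZero (ℕₚ.m<n⇒0<n∸m (m%n<n (s ℕ.* j) p)) ⦄)

      a+j≡p : p ∸ j ℕ.+ j ≡ p
      a+j≡p = ℕₚ.m∸n+n≡m (ℕₚ.<⇒≤ j<p)

      b+r≡p : suc B ℕ.+ residue j ≡ p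
      b+r≡p = ≡.trans (≡.cong (ℕ._+ residue j) (≡.sym b≡)) (ℕₚ.m∸n+n≡m (ℕₚ.<⇒≤ (m%n<n (s ℕ.* j) p)))

      -- Passing to -j replaces both residues by their complements, whose sum is 2p - (j + residue
      -- j); here j + residue j exceeds p.
      A+B+2<p : suc A ℕ.+ suc B < p
      A+B+2<p = ℕₚ.+-cancelʳ-< (j ℕ.+ residue j) (suc A ℕ.+ suc B) p
        (≡.subst (ℕ._< p ℕ.+ (j ℕ.+ residue j)) (≡.sym total) (ℕₚ.+-monoʳ-< p (ℕₚ.≰⇒> j+r≰p)))
        where
        total : (suc A ℕ.+ suc B) ℕ.+ (j ℕ.+ residue j) ≡ p ℕ.+ p
        total = ≡.trans (interchange (suc A) (suc B) j (residue j))
          (≡.cong₂ ℕ._+_ (≡.trans (≡.cong (ℕ._+ j) (≡.sym a≡)) a+j≡p) b+r≡p)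
          where
          open CommutativeSemigroupProperties ℕₚ.+-commutativeSemigroup using (interchange)

    -- Squaring removes the unknown sign in `root j` = ±j, so distinctness can be tested on the
    -- squares of the j.
    root-square : + root j * + root j ≈ + j * + j
    root-square = [ (λ eq → 𝔽.*-cong {+ root j} {+ j} eq eq)
                  , (λ eq → 𝔽.trans (𝔽.*-cong {+ root j} { - (+ j)} eq eq) (𝔽.reflexive (lemma (+ j)))) ]′
                  (IsRoot.a≈±j root-isRoot)
      where
      lemma : ∀ a → - a * - a ≡ a * a
      lemma = solve-∀

    p∤root : p ∤ root j
    p∤root p∣a = [ (λ a≈j → F.p∤ 0<j j<p (F.≈0⇒∣ (𝔽.trans (𝔽.sym a≈j) a≈0)))
                        , (λ a≈-j → F.p∤ 0<j j<p (F.≈0⇒∣ (𝔽.trans (𝔽.reflexive (≡.sym (ℤₚ.neg-involutive (+ j))))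
                                       (𝔽.-‿cong (𝔽.trans (𝔽.sym a≈-j) a≈0))))) ]′
                        (IsRoot.a≈±j root-isRoot)
      where
      a≈0 : + root j ≈ 0ℤ
      a≈0 = F.∣⇒≈0 p∣a

  -- Equal roots would give i² = j², so p would divide j - i or i + j. Both lie strictly between 0
  -- and p.
  root-injective : ∀ {i j} → 0 < i → i < j → i ℕ.+ j < p → ¬ (+ root i ≈ + root j)
  root-injective {i} {j} 0<i i<j i+j<p eq =
    [ (λ z → F.p∤ (ℕₚ.m<n⇒0<n∸m i<j) (ℕₚ.≤-<-trans (ℕₚ.m∸n≤m j i) j<p)
        (F.≈0⇒∣ (𝔽.trans (𝔽.reflexive (≡.trans (≡.sym (ℤₚ.⊖-≥ (ℕₚ.<⇒≤ i<j))) (≡.sym (ℤₚ.m-n≡m⊖n j i)))) z)))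
    , (λ z → F.p∤ (ℕₚ.<-≤-trans 0<i (ℕₚ.m≤m+n i j)) i+j<p (F.≈0⇒∣ z)) ]′
      (F.noZeroDivisors {+ j - + i} {+ i + + j} (begin
        (+ j - + i) * (+ i + + j)           ≡⟨ lemma (+ i) (+ j) ⟩
        + j * + j - + i * + i               ≈⟨ 𝔽.+-cong (𝔽.sym (root-square (ℕₚ.<-trans 0<i i<j) j<p)) (𝔽.-‿cong (𝔽.sym (root-square 0<i i<p))) ⟩
        + root j * + root j - + root i * + root i
          ≈⟨ 𝔽.+-congˡ {+ root j * + root j} (𝔽.-‿cong (𝔽.*-cong {+ root i} {+ root j} eq eq)) ⟩
        + root j * + root j - + root j * + root j  ≡⟨ ℤₚ.+-inverseʳ (+ root j * + root j) ⟩
        0ℤ ∎))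
    where
    i<p : i < p
    i<p = ℕₚ.≤-<-trans (ℕₚ.m≤m+n i j) i+j<p
    j<p : j < p
    j<p = ℕₚ.≤-<-trans (ℕₚ.m≤n+m j i) i+j<p

    lemma : ∀ i j → (j - i) * (i + j) ≡ j * j - i * i
    lemma = solve-∀

-- The polynomials b as series coefficients: vanishing, recurrences, degree.

module Binomials (N : ℕ) (p-prime : Prime (suc N)) where
  private
    p : ℕ
    p = suc N
  open TruncatedLogarithm p p-prime
  open 𝔽ₚ[α] renaming (_≈_ to _≈ₚ_; _+_ to _+ₚ_; _*_ to _*ₚ_)
  private
    module F = PrimeField p p-prime
    module 𝔽 = CommutativeRing 𝔽ₚ
    module R = CommutativeRing (PolynomialRing.commutativeRing 𝔽ₚ)
  open Evaluation 𝔽ₚ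
  open PolynomialProperties 𝔽ₚ
  open SemiringMult R.semiring using (×-comm-*) renaming (_×_ to _·_)
  open MonoidMult R.+-monoid using () renaming (×-congʳ to ·-congʳ)
  open NaturalCoefficients R.commutativeSemiring using (solve; con; _:+_; _:*_; _:=_)

  coeff-constant-* : ∀ a f n → coeff (constant a *ₚ f) n 𝔽.≈ a ℤ.* coeff f n
  coeff-constant-* a f n = 𝔽.trans (coeff-+ (map (a ℤ.*_) f) (0ℤ ∷ []) n)
    (𝔽.trans (𝔽.+-cong (coeff-map-* a f n) (0∷[] n)) (𝔽.+-identityʳ _))
    where
    0∷[] : ∀ n → coeff (0ℤ ∷ []) n 𝔽.≈ 0ℤ
    0∷[] zero    = 𝔽.refl
    0∷[] (suc n) = 𝔽.refl

  constant-* : ∀ a b → constant (a ℤ.* b) ≈ₚ constant a *ₚ constant b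
  constant-* a b = coeffwise λ
    { zero → 𝔽.reflexive (≡.sym (ℤₚ.+-identityʳ (a ℤ.* b))) ; (suc n) → 𝔽.refl }

  constant-cong : ∀ {a b} → a 𝔽.≈ b → constant a ≈ₚ constant b
  constant-cong a≈b = coeffwise λ { zero → a≈b ; (suc n) → 𝔽.refl }

  constant-0 : constant 0ℤ ≈ₚ 0#
  constant-0 = coeffwise λ { zero → 𝔽.refl ; (suc n) → 𝔽.refl }

  ·≈constant-* : ∀ n f → n · f ≈ₚ constant (+ n) *ₚ f
  ·≈constant-* zero    f = R.sym (R.trans (R.*-congʳ {f} constant-0) (R.zeroˡ f))
  ·≈constant-* (suc n) f = begin
    f +ₚ n · f                              ≈⟨ R.+-congˡ {f} (·≈constant-* n f) ⟩
    f +ₚ constant (+ n) *ₚ f                ≈⟨ solve 2 (λ f n → f :+ n :* f := (con 1 :+ n) :* f) R.refl f (constant (+ n)) ⟩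
    (1# +ₚ constant (+ n)) *ₚ f             ∎
    where open SetoidReasoning R.setoid

  coeff-· : ∀ n f k → coeff (n · f) k 𝔽.≈ + n ℤ.* coeff f k
  coeff-· n f k = 𝔽.trans (coeff-≈ (·≈constant-* n f) k) (coeff-constant-* (+ n) f k)

  ∏-snoc : ∀ m (f : ℕ → Poly) → ∏ {suc m} (f ∘ toℕ) ≈ₚ ∏ {m} (f ∘ toℕ) *ₚ f m
  ∏-snoc m f = R.trans (sum-init-last {m} (f ∘ toℕ))
    (R.*-cong (R.reflexive (sum-cong-≗ {m} λ i → ≡.cong f (toℕ-inject₁ i)))
              (R.reflexive (≡.cong f (toℕ-fromℕ m))))
    where open MonoidSum R.*-monoid using (sum-init-last; sum-cong-≗)

  falling : Poly → ℕ → Poly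
  falling z m = ∏ {m} λ i → z - constant (+ toℕ i)

  1/!-suc : ∀ m (m<p : m < p) (m+1<p : suc m < p) →
            + suc m ℤ.* 1/ (suc m !) (p∤! m+1<p) 𝔽.≈ 1/ (m !) (p∤! m<p)
  1/!-suc m m<p m+1<p = begin
    + suc m ℤ.* φ′                            ≡⟨ ℤₚ.*-identityˡ (+ suc m ℤ.* φ′) ⟨
    1ℤ ℤ.* (+ suc m ℤ.* φ′)                   ≈⟨ 𝔽.*-congʳ {+ suc m ℤ.* φ′} (proj₂ (F.inverse (m !) (p∤! m<p))) ⟨
    (+ (m !) ℤ.* φ) ℤ.* (+ suc m ℤ.* φ′)      ≡⟨ lemma (+ (m !)) φ (+ suc m) φ′ ⟩
    φ ℤ.* ((+ suc m ℤ.* + (m !)) ℤ.* φ′)      ≡⟨ ≡.cong (λ a → φ ℤ.* (a ℤ.* φ′)) (ℤₚ.pos-* (suc m) (m !)) ⟨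
    φ ℤ.* (+ (suc m !) ℤ.* φ′)                ≈⟨ 𝔽.*-congˡ {φ} (proj₂ (F.inverse (suc m !) (p∤! m+1<p))) ⟩
    φ ℤ.* 1ℤ                                  ≡⟨ ℤₚ.*-identityʳ φ ⟩
    φ                                         ∎
    where
    open SetoidReasoning 𝔽.setoid
    φ φ′ : ℤ
    φ  = 1/ (m !) (p∤! m<p)
    φ′ = 1/ (suc m !) (p∤! m+1<p)
    lemma : ∀ a b c d → (a ℤ.* b) ℤ.* (c ℤ.* d) ≡ b ℤ.* ((c ℤ.* a) ℤ.* d)
    lemma = solve-∀

  -- Coefficient form of (1 + X) g′ = z g for g = (1 + X)^z. It holds because the next binomial is
  -- the current one times (z - m)/(m + 1).
  binomial-suc : ∀ z m (m<p : m < p) (m+1<p : suc m < p) →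
    suc m · binomial z (suc m) m+1<p +ₚ m · binomial z m m<p ≈ₚ z *ₚ binomial z m m<p
  binomial-suc z m m<p m+1<p = begin
    suc m · (constant φ′ *ₚ falling z (suc m)) +ₚ m · B
      ≈⟨ R.+-cong (·≈constant-* (suc m) _) (·≈constant-* m B) ⟩
    c[m+1] *ₚ (constant φ′ *ₚ falling z (suc m)) +ₚ c[m] *ₚ B
      ≈⟨ R.+-congʳ {c[m] *ₚ B} (R.*-congˡ {c[m+1]} (R.*-congˡ {constant φ′} (∏-snoc m λ i → z - constant (+ i)))) ⟩
    c[m+1] *ₚ (constant φ′ *ₚ (falling z m *ₚ (z +ₚ - c[m]))) +ₚ c[m] *ₚ B
      ≈⟨ R.+-congʳ {c[m] *ₚ B} (solve 5 (λ a b f z e → a :* (b :* (f :* (z :+ e))) := (a :* b) :* f :* (z :+ e)) R.refl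
           c[m+1] (constant φ′) (falling z m) z (- c[m])) ⟩
    (c[m+1] *ₚ constant φ′) *ₚ falling z m *ₚ (z +ₚ - c[m]) +ₚ c[m] *ₚ B
      ≈⟨ R.+-congʳ {c[m] *ₚ B} (R.*-congʳ {z +ₚ - c[m]} (R.*-congʳ {falling z m}
           (R.trans (R.sym (constant-* (+ suc m) φ′)) (constant-cong (1/!-suc m m<p m+1<p))))) ⟩
    B *ₚ (z +ₚ - c[m]) +ₚ c[m] *ₚ B
      ≈⟨ solve 4 (λ b z e c → b :* (z :+ e) :+ c :* b := z :* b :+ (c :+ e) :* b) R.refl B z (- c[m]) c[m] ⟩
    z *ₚ B +ₚ (c[m] +ₚ - c[m]) *ₚ B
      ≈⟨ R.+-congˡ {z *ₚ B} (R.trans (R.*-congʳ {B} (R.-‿inverseʳ c[m])) (R.zeroˡ B)) ⟩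
    z *ₚ B +ₚ 0#
      ≈⟨ R.+-identityʳ (z *ₚ B) ⟩
    z *ₚ B ∎
    where
    open SetoidReasoning R.setoid
    φ′ : ℤ
    φ′ = 1/ (suc m !) (p∤! m+1<p)
    B c[m] c[m+1] : Poly
    B      = binomial z m m<p
    c[m]   = constant (+ m)
    c[m+1] = constant (+ suc m)

  binomial-0 : ∀ z (0<p : 0 < p) → binomial z 0 0<p ≈ₚ 1#
  binomial-0 z 0<p = R.trans (R.*-identityʳ (constant (1/ 1 (p∤! 0<p))))
    (constant-cong (𝔽.trans (𝔽.reflexive (≡.sym (ℤₚ.*-identityˡ (1/ 1 (p∤! 0<p))))) (proj₂ (F.inverse 1 (p∤! 0<p)))))

  -- Series are total functions, whereas `binomial` exists only below p, where m! is invertible. The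
  -- default `0#` starts at X^p, just beyond the coefficients up to X^N on which the recurrences
  -- run.
  binomial₀ : Poly → ℕ → Poly
  binomial₀ z m with m ℕₚ.<? p
  ... | yes m<p = binomial z m m<p
  ... | no  _   = 0#

  binomial₀-< : ∀ z m (m<p : m < p) → binomial₀ z m ≡ binomial z m m<p
  binomial₀-< z m m<p with m ℕₚ.<? p
  ... | yes q   = ≡.cong (binomial z m) (ℕₚ.<-irrelevant q m<p)
  ... | no  m≮p = ⊥-elim (m≮p m<p)

  binomial₀-suc : ∀ z m → m < N →
    suc m · binomial₀ z (suc m) +ₚ m · binomial₀ z m ≈ₚ z *ₚ binomial₀ z m
  binomial₀-suc z m m<N
    rewrite binomial₀-< z m (ℕₚ.m<n⇒m<1+n m<N) | binomial₀-< z (suc m) (s≤s m<N)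
    = binomial-suc z m (ℕₚ.m<n⇒m<1+n m<N) (s≤s m<N)

  eval-∑≈0 : ∀ a {n} (f : Fin n → Poly) → (∀ i → eval a (f i) 𝔽.≈ 0ℤ) → eval a (∑ f) 𝔽.≈ 0ℤ
  eval-∑≈0 a {zero}  f f≈0 = 𝔽.refl
  eval-∑≈0 a {suc n} f f≈0 = 𝔽.trans (eval-+ a (f zero) (∑ (f ∘ suc)))
    (𝔽.+-cong {eval a (f zero)} {0ℤ} {eval a (∑ (f ∘ suc))} {0ℤ} (f≈0 zero) (eval-∑≈0 a (f ∘ suc) (f≈0 ∘ suc)))

  eval-*≈0ˡ : ∀ a f g → eval a f 𝔽.≈ 0ℤ → eval a (f *ₚ g) 𝔽.≈ 0ℤ
  eval-*≈0ˡ a f g f≈0 = 𝔽.trans (eval-* a f g)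
    (𝔽.trans (𝔽.*-congʳ {eval a g} f≈0) (𝔽.zeroˡ (eval a g)))

  eval-*≈0ʳ : ∀ a f g → eval a g 𝔽.≈ 0ℤ → eval a (f *ₚ g) 𝔽.≈ 0ℤ
  eval-*≈0ʳ a f g g≈0 = 𝔽.trans (eval-* a f g)
    (𝔽.trans (𝔽.*-congˡ {eval a f} g≈0) (𝔽.zeroʳ (eval a f)))

  eval-∏≈0 : ∀ a {n} (f : Fin n → Poly) i → eval a (f i) 𝔽.≈ 0ℤ → eval a (∏ f) 𝔽.≈ 0ℤ
  eval-∏≈0 a f zero    f≈0 = eval-*≈0ˡ a (f zero) (∏ (f ∘ suc)) f≈0
  eval-∏≈0 a f (suc i) f≈0 = eval-*≈0ʳ a (f zero) (∏ (f ∘ suc)) (eval-∏≈0 a (f ∘ suc) i f≈0)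

  eval-minus-constant : ∀ a f b → eval a (f - constant b) 𝔽.≈ eval a f ℤ.- b
  eval-minus-constant a f b = 𝔽.trans (eval-+ a f (- constant b))
    (𝔽.+-congˡ {eval a f} (𝔽.trans (eval-neg a (constant b)) (𝔽.-‿cong (eval-constant a b))))

  -- The falling factorial contains the factor z - A, with index A < m, and this factor vanishes at
  -- a.
  eval-binomial≈0 : ∀ a z m (m<p : m < p) A → eval a z 𝔽.≈ + A → A < m →
                    eval a (binomial z m m<p) 𝔽.≈ 0ℤ
  eval-binomial≈0 a z m m<p A z≈A A<m =
    eval-*≈0ʳ a (constant (1/ (m !) (p∤! m<p))) (falling z m)
      (eval-∏≈0 a (λ i → z - constant (+ toℕ i)) (fromℕ< A<m)
        (≡.subst (λ i → eval a (z - constant (+ i)) 𝔽.≈ 0ℤ) (≡.sym (toℕ-fromℕ< A<m))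
          (𝔽.trans (eval-minus-constant a z (+ A))
            (𝔽.trans (𝔽.+-congʳ {ℤ.- (+ A)} z≈A) (𝔽.-‿inverseʳ (+ A))))))

  eval-argument : ∀ a s A → + s ℤ.* + a 𝔽.≈ + suc A → eval (+ a) (constant (+ s) *ₚ α - 1#) 𝔽.≈ + A
  eval-argument a s A sa≈ = 𝔽.trans (eval-minus-constant (+ a) (constant (+ s) *ₚ α) 1ℤ)
    (𝔽.trans (𝔽.+-congʳ {ℤ.- 1ℤ} (𝔽.trans (eval-* (+ a) (constant (+ s)) α)
      (𝔽.trans (𝔽.*-cong {eval (+ a) (constant (+ s))} {+ s} {eval (+ a) α} {+ a} (eval-constant (+ a) (+ s)) (eval-X (+ a))) sa≈)))
      (𝔽.reflexive (lemma (+ A))))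
    where
    lemma : ∀ a → (1ℤ ℤ.+ a) ℤ.- 1ℤ ≡ a
    lemma = solve-∀

  module _ (s : ℕ) (0<s : 0 < s) (s<p : s < p) where
    open SemiringExp 𝔽.semiring using () renaming (_^_ to _^ₚ_)

    -- With x = -1/s the second factor of the series is (1 + x X)^v. The spelling of x, u and v
    -- follows `b` literally, including the factor 1, so that the sum of `term` is `b 1 s` by
    -- definition.
    x : ℤ
    x = 𝔽.- (+ 1) 𝔽.* 1/ s (p∤ 0<s s<p)

    u v : Poly
    u = constant (+ 1) *ₚ α - 1#
    v = constant (+ s) *ₚ α - 1#

    N∸k<p : (k : Fin p) → N ∸ toℕ k < p
    N∸k<p k = ℕₚ.≤-<-trans (ℕₚ.m∸n≤m N (toℕ k)) p∸1<p

    xᵏ U V term : Fin p → Poly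
    xᵏ k   = constant (x ^ₚ toℕ k)
    U k    = binomial u (N ∸ toℕ k) (N∸k<p k)
    V k    = binomial v (toℕ k) (toℕ<n k)
    term k = xᵏ k *ₚ U k *ₚ V k

    b-root : ∀ a A B → a ≡ suc A → + s ℤ.* + a 𝔽.≈ + suc B →
             A ℕ.+ B < N → eval (+ a) (b 1 s 0<s s<p) 𝔽.≈ 0ℤ
    b-root a A B a≡ sa≈ A+B<N = eval-∑≈0 (+ a) term λ k → [ left k , right k ]′ (split k)
      where
      split : ∀ k → A < N ∸ toℕ k ⊎ B < toℕ k
      split k with B ℕₚ.<? toℕ k
      ... | yes B<k = inj₂ B<k
      ... | no  B≮k = inj₁ (ℕₚ.m+n≤o⇒m≤o∸n (suc A)
        (ℕₚ.≤-trans (ℕₚ.+-monoʳ-≤ (suc A) (ℕₚ.≮⇒≥ B≮k)) A+B<N))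

      left : ∀ k → A < N ∸ toℕ k → eval (+ a) (term k) 𝔽.≈ 0ℤ
      left k A<N∸k = eval-*≈0ˡ (+ a) (xᵏ k *ₚ U k) (V k) (eval-*≈0ʳ (+ a) (xᵏ k) (U k)
        (eval-binomial≈0 (+ a) u (N ∸ toℕ k) (N∸k<p k) A
          (eval-argument a 1 A (𝔽.reflexive (≡.trans (ℤₚ.*-identityˡ (+ a)) (≡.cong +_ a≡)))) A<N∸k))

      right : ∀ k → B < toℕ k → eval (+ a) (term k) 𝔽.≈ 0ℤ
      right k B<k = eval-*≈0ʳ (+ a) (xᵏ k *ₚ U k) (V k)
        (eval-binomial≈0 (+ a) v (toℕ k) (toℕ<n k) B (eval-argument a s B sa≈) B<k)

    open Convolution (PolynomialRing.commutativeRing 𝔽ₚ)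

    X̂ : Poly
    X̂ = constant x

    f g : ℕ → Poly
    f k = constant (x ^ₚ k) *ₚ binomial₀ v k
    g k = binomial₀ u k

    -- F′ n is the coefficient of Xⁿ in (1 + X)ᵘ (1 + x X)ᵛ; for P′ and Q′ the derivation X d/dX
    -- is applied to the first and to the second factor, respectively.

    F′ P′ Q′ : ℕ → Poly
    F′ = conv f g
    P′ = conv f (weighted g)
    Q′ = conv (weighted f) g

    b≈F′ : b 1 s 0<s s<p ≈ₚ F′ N
    b≈F′ = sum≈conv N f g term λ k → R.trans
      (solve 3 (λ a b c → a :* b :* c := a :* c :* b) R.refl (xᵏ k) (U k) (V k))
      (R.reflexive (≡.cong₂ (λ a b → xᵏ k *ₚ a *ₚ b)
        (≡.sym (binomial₀-< v (toℕ k) (toℕ<n k)))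
        (≡.sym (binomial₀-< u (N ∸ toℕ k) (N∸k<p k)))))

    -- With D = X d/dX this is (1 + x X) D f = x v X f for f = (1 + x X)^v: the binomial recurrence
    -- multiplied by x^(k+1).
    f-suc : ∀ k → k < N → suc k · f (suc k) +ₚ X̂ *ₚ (k · f k) ≈ₚ (X̂ *ₚ v) *ₚ f k
    f-suc k k<N = begin
      suc k · (constant (x ℤ.* x ^ₚ k) *ₚ binomial₀ v (suc k)) +ₚ X̂ *ₚ (k · (y *ₚ B))
        ≈⟨ R.+-cong (·-congʳ (suc k) (R.*-congʳ {B′} (constant-* x (x ^ₚ k)))) (R.*-congˡ {X̂} (R.sym (×-comm-* k y B))) ⟩
      suc k · ((X̂ *ₚ y) *ₚ B′) +ₚ X̂ *ₚ (y *ₚ (k · B))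
        ≈⟨ R.+-cong (R.sym (×-comm-* (suc k) (X̂ *ₚ y) B′)) (R.sym (R.*-assoc X̂ y (k · B))) ⟩
      (X̂ *ₚ y) *ₚ (suc k · B′) +ₚ (X̂ *ₚ y) *ₚ (k · B)
        ≈⟨ R.distribˡ (X̂ *ₚ y) (suc k · B′) (k · B) ⟨
      (X̂ *ₚ y) *ₚ (suc k · B′ +ₚ k · B)
        ≈⟨ R.*-congˡ {X̂ *ₚ y} (binomial₀-suc v k k<N) ⟩
      (X̂ *ₚ y) *ₚ (v *ₚ B)
        ≈⟨ solve 4 (λ x y v b → (x :* y) :* (v :* b) := (x :* v) :* (y :* b)) R.refl X̂ y v B ⟩
      (X̂ *ₚ v) *ₚ (y *ₚ B) ∎
      where
      open SetoidReasoning R.setoid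
      y B B′ : Poly
      y  = constant (x ^ₚ k)
      B  = binomial₀ v k
      B′ = binomial₀ v (suc k)

    Q+P : ∀ n → Q′ n +ₚ P′ n ≈ₚ n · F′ n
    Q+P = conv-weighted f g

    P-suc : ∀ n → n < N → P′ (suc n) +ₚ P′ n ≈ₚ u *ₚ F′ n
    P-suc n n<N = R.trans (R.+-congˡ {P′ (suc n)} (R.sym (R.*-identityˡ (P′ n))))
      (conv-recurrence f g (weighted g) 1# u n R.refl λ m m≤n →
        R.trans (R.+-congˡ {suc m · g (suc m)} (R.*-identityˡ (m · g m)))
          (binomial₀-suc u m (ℕₚ.≤-<-trans m≤n n<N)))

    Q-suc : ∀ n → n < N → Q′ (suc n) +ₚ X̂ *ₚ Q′ n ≈ₚ (X̂ *ₚ v) *ₚ F′ n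
    Q-suc n n<N = begin
      Q′ (suc n) +ₚ X̂ *ₚ Q′ n
        -- `conv-recurrence` wants the differentiated factor in second place.
        ≈⟨ R.+-cong (conv-comm (weighted f) g (suc n)) (R.*-congˡ {X̂} (conv-comm (weighted f) g n)) ⟩
      conv g (weighted f) (suc n) +ₚ X̂ *ₚ conv g (weighted f) n
        ≈⟨ conv-recurrence g f (weighted f) X̂ (X̂ *ₚ v) n R.refl (λ m m≤n → f-suc m (ℕₚ.≤-<-trans m≤n n<N)) ⟩
      (X̂ *ₚ v) *ₚ conv g f n
        ≈⟨ R.*-congˡ {X̂ *ₚ v} (conv-comm g f n) ⟩
      (X̂ *ₚ v) *ₚ F′ n ∎
      where open SetoidReasoning R.setoid

    s*1/s≈1 : + s ℤ.* 1/ s (p∤ 0<s s<p) 𝔽.≈ 1ℤ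
    s*1/s≈1 = proj₂ (F.inverse s (p∤ 0<s s<p))

    xs≈-1 : x ℤ.* + s 𝔽.≈ -1ℤ
    xs≈-1 = 𝔽.trans (𝔽.reflexive (lemma (1/ s (p∤ 0<s s<p)) (+ s))) (𝔽.-‿cong s*1/s≈1)
      where
      lemma : ∀ y s → (-1ℤ ℤ.* y) ℤ.* s ≡ ℤ.- (s ℤ.* y)
      lemma = solve-∀

    -- The terms linear in α cancel; this is what halves the degree.

    u+xv : u +ₚ X̂ *ₚ v ≈ₚ constant (-1ℤ ℤ.+ ℤ.- x)
    u+xv = coeffwise λ
      { zero          → 𝔽.reflexive (lemma₀ x (+ s))
      ; (suc zero)    → 𝔽.trans (𝔽.reflexive (lemma₁ x (+ s))) (𝔽.+-congˡ {1ℤ} xs≈-1)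
      ; (suc (suc n)) → 𝔽.refl
      }
      where
      lemma₀ : ∀ x s → -1ℤ ℤ.+ (x ℤ.* (s ℤ.* 0ℤ ℤ.+ 0ℤ ℤ.+ -1ℤ) ℤ.+ 0ℤ) ≡ -1ℤ ℤ.+ ℤ.- x
      lemma₀ = solve-∀
      lemma₁ : ∀ x s → 1ℤ ℤ.+ x ℤ.* (s ℤ.* 1ℤ) ≡ 1ℤ ℤ.+ x ℤ.* s
      lemma₁ = solve-∀

    -- By the product rule (n + 1) F′ (n + 1) splits into its P and Q parts. Adding `P-suc` and
    -- `Q-suc` then leaves F′ n times u + x v, where α has dropped out.
    F-suc : ∀ n → n < N →
            suc n · F′ (suc n) +ₚ (P′ n +ₚ X̂ *ₚ Q′ n) ≈ₚ constant (-1ℤ ℤ.+ ℤ.- x) *ₚ F′ n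
    F-suc n n<N = begin
      suc n · F′ (suc n) +ₚ (P′ n +ₚ X̂ *ₚ Q′ n)
        ≈⟨ R.+-congʳ {P′ n +ₚ X̂ *ₚ Q′ n} (Q+P (suc n)) ⟨
      (Q′ (suc n) +ₚ P′ (suc n)) +ₚ (P′ n +ₚ X̂ *ₚ Q′ n)
        ≈⟨ solve 4 (λ a b c d → (a :+ b) :+ (c :+ d) := (b :+ c) :+ (a :+ d)) R.refl
             (Q′ (suc n)) (P′ (suc n)) (P′ n) (X̂ *ₚ Q′ n) ⟩
      (P′ (suc n) +ₚ P′ n) +ₚ (Q′ (suc n) +ₚ X̂ *ₚ Q′ n)
        ≈⟨ R.+-cong (P-suc n n<N) (Q-suc n n<N) ⟩
      u *ₚ F′ n +ₚ (X̂ *ₚ v) *ₚ F′ n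
        ≈⟨ R.distribʳ (F′ n) u (X̂ *ₚ v) ⟨
      (u +ₚ X̂ *ₚ v) *ₚ F′ n
        ≈⟨ R.*-congʳ {F′ n} u+xv ⟩
      constant (-1ℤ ℤ.+ ℤ.- x) *ₚ F′ n ∎
      where open SetoidReasoning R.setoid

    module _ (s+1<p : suc s < p) where

      -- As x s = -1, the value x = 1 would make p divide s + 1, which the bound on s + 1 forbids.
      x≉1 : ¬ (x 𝔽.≈ 1ℤ)
      x≉1 x≈1 = p∤ (s≤s z≤n) s+1<p (F.≈0⇒∣ (begin
        + suc s             ≡⟨ lemma (+ s) ⟩
        1ℤ ℤ.+ 1ℤ ℤ.* + s   ≈⟨ 𝔽.+-congˡ {1ℤ} (𝔽.*-congʳ {+ s} x≈1) ⟨
        1ℤ ℤ.+ x ℤ.* + s    ≈⟨ 𝔽.+-congˡ {1ℤ} xs≈-1 ⟩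
        1ℤ ℤ.+ -1ℤ          ∎))
        where
        open SetoidReasoning 𝔽.setoid
        lemma : ∀ s → 1ℤ ℤ.+ s ≡ 1ℤ ℤ.+ 1ℤ ℤ.* s
        lemma = solve-∀

      F₀≈1 : F′ 0 ≈ₚ 1#
      F₀≈1 = begin
        (1# *ₚ binomial₀ v 0) *ₚ binomial₀ u 0
          ≡⟨ ≡.cong₂ (λ a b → (1# *ₚ a) *ₚ b) (binomial₀-< v 0 (s≤s z≤n)) (binomial₀-< u 0 (s≤s z≤n)) ⟩
        (1# *ₚ binomial v 0 (s≤s z≤n)) *ₚ binomial u 0 (s≤s z≤n)
          ≈⟨ R.*-cong (R.*-congˡ {1#} (binomial-0 v (s≤s z≤n))) (binomial-0 u (s≤s z≤n)) ⟩
        (1# *ₚ 1#) *ₚ 1#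
          ≈⟨ solve 0 ((con 1 :* con 1) :* con 1 := con 1) R.refl ⟩
        1# ∎
        where open SetoidReasoning R.setoid

      F P Q : ℕ → ℕ → ℤ
      F n k = coeff (F′ n) k
      P n k = coeff (P′ n) k
      Q n k = coeff (Q′ n) k

      P₀ : ∀ k → P 0 k 𝔽.≈ 0ℤ
      P₀ = coeff-≈ (R.zeroʳ (f 0))

      coeff-P-suc : ∀ n k → n < N →
        P (suc n) (suc k) ℤ.+ P n (suc k) 𝔽.≈ -1ℤ ℤ.* F n (suc k) ℤ.+ 1ℤ ℤ.* F n k
      coeff-P-suc n k n<N = 𝔽.trans (𝔽.sym (coeff-+ (P′ (suc n)) (P′ n) (suc k)))
        (𝔽.trans (coeff-≈ (P-suc n n<N) (suc k)) (coeff-linear-* -1ℤ 1ℤ (F′ n) k))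

      coeff-Q+P : ∀ n k → Q n k ℤ.+ P n k 𝔽.≈ + n ℤ.* F n k
      coeff-Q+P n k = 𝔽.trans (𝔽.sym (coeff-+ (Q′ n) (P′ n) k))
        (𝔽.trans (coeff-≈ (Q+P n) k) (coeff-· n (F′ n) k))

      coeff-F-suc : ∀ n k → n < N →
        + suc n ℤ.* F (suc n) k ℤ.+ (P n k ℤ.+ x ℤ.* Q n k) 𝔽.≈ (-1ℤ ℤ.+ ℤ.- x) ℤ.* F n k
      coeff-F-suc n k n<N = begin
        + suc n ℤ.* F (suc n) k ℤ.+ (P n k ℤ.+ x ℤ.* Q n k)
          ≈⟨ 𝔽.+-cong (coeff-· (suc n) (F′ (suc n)) k)
               (𝔽.trans (coeff-+ (P′ n) (X̂ *ₚ Q′ n) k) (𝔽.+-congˡ {P n k} (coeff-constant-* x (Q′ n) k))) ⟨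
        coeff (suc n · F′ (suc n)) k ℤ.+ coeff (P′ n +ₚ X̂ *ₚ Q′ n) k
          ≈⟨ coeff-+ (suc n · F′ (suc n)) (P′ n +ₚ X̂ *ₚ Q′ n) k ⟨
        coeff (suc n · F′ (suc n) +ₚ (P′ n +ₚ X̂ *ₚ Q′ n)) k
          ≈⟨ coeff-≈ (F-suc n n<N) k ⟩
        coeff (constant (-1ℤ ℤ.+ ℤ.- x) *ₚ F′ n) k
          ≈⟨ coeff-constant-* (-1ℤ ℤ.+ ℤ.- x) (F′ n) k ⟩
        (-1ℤ ℤ.+ ℤ.- x) ℤ.* F n k ∎
        where open SetoidReasoning 𝔽.setoid

      open Recurrence N p-prime

      b-degree : ∀ k → N < k ℕ.+ k → coeff (b 1 s 0<s s<p) k 𝔽.≈ 0ℤ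
      b-degree k N<2k = 𝔽.trans (coeff-≈ b≈F′ k)
        (degree x x≉1 F P Q (coeff-≈ F₀≈1 0) (coeff-≈ F₀≈1 ∘ suc) P₀ coeff-Q+P coeff-P-suc coeff-F-suc
          N ℕₚ.≤-refl k N<2k)

      b-leading≉0 : ∀ h → N ≡ h ℕ.+ h → ¬ (coeff (b 1 s 0<s s<p) h 𝔽.≈ 0ℤ)
      b-leading≉0 h N≡2h b≈0 =
        leading≉0 x x≉1 F P Q (coeff-≈ F₀≈1 0) (coeff-≈ F₀≈1 ∘ suc) P₀ coeff-Q+P coeff-P-suc coeff-F-suc
          h (ℕₚ.≤-reflexive (≡.sym N≡2h))
          (𝔽.trans (𝔽.reflexive (≡.cong (λ n → F n h) (≡.sym N≡2h))) (𝔽.trans (𝔽.sym (coeff-≈ b≈F′ h)) b≈0))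

-- The denominators divide powers of α^(p-1) - 1, and the theorem.

module Denominators (N : ℕ) (p-prime : Prime (suc N)) (h : ℕ) (N≡2h : N ≡ h ℕ.+ h) where
  private
    p : ℕ
    p = suc N
  open TruncatedLogarithm p p-prime
  open Binomials N p-prime
  open Localisation N p-prime

  module _ (s : ℕ) (0<s : 0 < s) (s<p : s < p) (s+1<p : suc s < p) where
    open Roots N p-prime s (p∤ 0<s s<p)

    private
      h<p : h < p
      h<p = s≤s (≡.subst (h ≤_) (≡.sym N≡2h) (ℕₚ.m≤m+n h h))

    b-dividesPower : DividesPower (b 1 s 0<s s<p)
    -- The pairs ±1, ..., ±h supply as many roots as the degree h = (p - 1)/2 allows. They are
    -- distinct because two different indices from 1 to h have sum at most 2h = p - 1.
    b-dividesPower = splits-dividesPower h (root ∘ suc)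
      (λ i i<h → p∤root (s≤s z≤n) (ℕₚ.≤-<-trans i<h h<p))
      (λ i j i<j j<h → root-injective (s≤s z≤n) (s≤s i<j)
        (s≤s (≡.subst (suc i ℕ.+ suc j ≤_) (≡.sym N≡2h) (ℕₚ.+-mono-≤ (ℕₚ.<-trans i<j j<h) j<h))))
      (b 1 s 0<s s<p)
      (λ b≈0 → b-leading≉0 s 0<s s<p s+1<p h N≡2h (𝔽ₚ[α].coeff-≈ b≈0 h))
      (λ n h<n → b-degree s 0<s s<p s+1<p n (≡.subst (_< n ℕ.+ n) (≡.sym N≡2h) (ℕₚ.+-mono-< h<n h<n)))
      λ i i<h → let open IsRoot (root-isRoot (s≤s z≤n) (ℕₚ.≤-<-trans i<h h<p))
                in b-root s 0<s s<p (root (suc i)) A B a≡ sa≈ A+B<N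

  denominator-dividesPower : ∀ j → DividesPower (denominator j)
  denominator-dividesPower j = ∏-dividesPower _ λ i →
    b-dividesPower (suc (toℕ i)) (s≤s z≤n) (ℕₚ.≤-<-trans (toℕ<n i) (ℕₚ.<-trans (ℕₚ.n<1+n (toℕ j)) (1+toℕ<p j)))
      -- Here s = i + 1 ≤ j ≤ p - 2, so the exceptional value s = p - 1 is never reached.
      (s≤s (ℕₚ.≤-trans (s≤s (toℕ<n i)) (toℕ<n j)))

theorem5 : (p : ℕ) (p-prime : Prime p) → ¬ (2 ∣ p) →
    let open TruncatedLogarithm p p-prime in
    Σ (∀ j → 𝔽ₚ[α]._≉_ (denominator j) 𝔽ₚ[α].0#) λ denominator≉0 →
    ∀ n → 𝔽ₚ[α,1/αᵖ⁻¹-1] (𝔽ₚ⟨α⟩[X].coeff (G denominator≉0) n)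
-- Writing p as `suc N` lets `p ∸ 1` compute to `N`, the form used by all the preceding modules.
theorem5 zero    0-prime = ⊥-elim (¬prime[0] 0-prime)
theorem5 (suc N) p-prime 2∤p = ≉0 , G-members denominator-dividesPower ≉0
  where
  h : ℕ
  h = suc N / 2

  p≡ : suc N ≡ suc (h ℕ.+ h)
  p≡ with suc N % 2 in eq | m%n<n (suc N) 2 | m≡m%n+[m/n]*n (suc N) 2
  ... | 0 | _ | _  = ⊥-elim (2∤p (m%n≡0⇒n∣m (suc N) 2 eq))
  ... | 1 | _ | p≡ = ≡.trans p≡ (≡.cong suc (≡.trans (ℕₚ.*-comm h 2) (≡.cong (h ℕ.+_) (ℕₚ.+-identityʳ h))))
  ... | suc (suc _) | s≤s (s≤s ()) | _

  open Denominators N p-prime h (ℕₚ.suc-injective p≡)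
  open Localisation N p-prime
  ≉0 : ∀ j → _
  ≉0 j = dividesPower⇒≉0 (denominator-dividesPower j)
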